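{- There is an absolute constant $c>0$ such that for every $n\ge 2$ and all sufficiently small $\varepsilon>0$ (depending on $n$), the cardinal complexity (with parameter $\varepsilon$) of the $n$-face die guessing game is at least $$\underbrace{2^{2^{\cdot^{\cdot^{\cdot^{\,c/((6n)^{7n}\varepsilon)}}}}}}_{n-2\ \text{twos}},$$ i.e. the result of applying $x\mapsto 2^x$ exactly $n-2$ times to $\frac{c}{(6n)^{7n}\varepsilon}$.
   Context: Die guessing game. A die has $n$ faces with $n$ distinct integers from $[N]=\{1,\dots,N\}$ written on them: the adversary picks an $n$-element set $S\subseteq[N]$ and the numbers are assigned to the faces by a uniformly random permutation. The die is rolled (the order of the faces is uniformly random); the algorithm sees the $n-1$ numbers on all faces but the last (hidden) one, and guesses the rank, in $\{1,\dots,n\}$, of the hidden number among the $n$ numbers of $S$. The reward is $1$ if the guess is correct and $0$ otherwise. An ordinal algorithm only sees the relative order of the visible numbers; the best expected reward of an ordinal algorithm is $1/n$. A general (cardinal) algorithm sees the actual values. Algorithms may be randomized. Cardinal complexity. For a parameter $\varepsilon>0$, the cardinal complexity of the game is the minimum $N$ such that there is a distribution $\mathcal{F}$ over $n$-element subsets of $[N]$ for which, when $S\sim\mathcal{F}$, every algorithm (even knowing $\mathcal{F}$) has expected reward at most $(1+\varepsilon)$ times the best expected reward of an ordinal algorithm, i.e. at most $(1+\varepsilon)/n$. -}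

module Defs where

open import Algebra.Bundles using (CommutativeMonoid)
import Algebra.Definitions.RawSemiring
import Algebra.Properties.CommutativeSemigroup
open import Data.Bool.Base using (if_then_else_)
open import Data.Fin.Base using (Fin; toℕ)
import Data.Fin.Properties as Fin
open import Data.Fin.Subset using (Subset; inside; outside; ∣_∣; _∈_)
open import Data.Fin.Subset.Properties using (_∈?_)
open import Data.Integer.Base as ℤ using (ℤ; +_; -[1+_])
open import Data.List.Base using (List; []; _∷_; [_]; map; foldr; filter; allFin; cartesianProduct; cartesianProductWith)
import Data.List.Membership.Propositional as List
open import Data.Nat.Base as ℕ using (ℕ; zero; suc; pred; _!)
import Data.Nat.Properties as ℕ
open import Data.Product.Base using (Σ-syntax; ∃-syntax; _×_; _,_)
open import Data.Rational.Base as ℚ using (ℚ; 0ℚ; 1ℚ; ½; 1/_)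
import Data.Rational.Properties as ℚ
open import Data.Vec.Base as Vec using (Vec; []; _∷_)
open import Data.Vec.Relation.Unary.All as All using (All)
open import Data.Vec.Relation.Unary.AllPairs using (allPairs?)
open import Data.Vec.Relation.Unary.Unique.Propositional using (Unique)
open import Relation.Binary.PropositionalEquality as Eq using (_≡_; sym; subst)
open import Relation.Nullary.Decidable using (Dec; does; _×-dec_; ¬?)

open Algebra.Definitions.RawSemiring ℚ.+-*-rawSemiring using () renaming (_^_ to _^ℚ_)
open Algebra.Properties.CommutativeSemigroup (CommutativeMonoid.commutativeSemigroup ℚ.+-0-commutativeMonoid) using (interchange)

------------------------------------------------------------------------
-- Real numbers as Cauchy sequences of rationals.  No quotient is taken:
-- two sequences denote the same real when they are related by _≈ℝ_.

IsCauchy : (ℕ → ℚ) → Set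
IsCauchy x = ∀ δ → 0ℚ ℚ.< δ →
  ∃[ M ] (∀ m n → M ℕ.≤ m → M ℕ.≤ n → ℚ.∣ x m ℚ.- x n ∣ ℚ.< δ)

record ℝ : Set where
  constructor mkℝ
  field
    seq    : ℕ → ℚ
    cauchy : IsCauchy seq

open ℝ public

infix 4 _≤ℝ_ _<ℝ_ _≈ℝ_

_≤ℝ_ : ℝ → ℝ → Set
x ≤ℝ y = ∀ δ → 0ℚ ℚ.< δ → ∃[ M ] (∀ n → M ℕ.≤ n → seq x n ℚ.≤ seq y n ℚ.+ δ)

_<ℝ_ : ℝ → ℝ → Set
x <ℝ y = ∃[ δ ] (0ℚ ℚ.< δ × ∃[ M ] (∀ n → M ℕ.≤ n → seq x n ℚ.+ δ ℚ.≤ seq y n))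

_≈ℝ_ : ℝ → ℝ → Set
x ≈ℝ y = x ≤ℝ y × y ≤ℝ x

private
  0<½ : 0ℚ ℚ.< ½
  0<½ = ℚ.positive⁻¹ ½

  0<1 : 0ℚ ℚ.< 1ℚ
  0<1 = ℚ.positive⁻¹ 1ℚ

  share : ∀ B δ → 0ℚ ℚ.< B → 0ℚ ℚ.< δ → ∃[ η ] (0ℚ ℚ.< η × B ℚ.* η ≡ δ)
  share B δ 0<B 0<δ = B⁻¹ ℚ.* δ , 0<η , eq
    where
    instance
      B-pos = ℚ.positive 0<B
      δ-pos = ℚ.positive 0<δ
      B-nz  = ℚ.pos⇒nonZero B
    B⁻¹ = 1/ B
    0<η : 0ℚ ℚ.< B⁻¹ ℚ.* δ
    0<η = ℚ.positive⁻¹ _ {{ℚ.pos*pos⇒pos B⁻¹ {{ℚ.1/pos⇒pos B}} δ}}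
    eq : B ℚ.* (B⁻¹ ℚ.* δ) ≡ δ
    eq = begin
      B ℚ.* (B⁻¹ ℚ.* δ)   ≡⟨ ℚ.*-assoc B B⁻¹ δ ⟨
      (B ℚ.* B⁻¹) ℚ.* δ   ≡⟨ Eq.cong (ℚ._* δ) (ℚ.*-inverseʳ B) ⟩
      1ℚ ℚ.* δ            ≡⟨ ℚ.*-identityˡ δ ⟩
      δ                   ∎
      where
      open Eq.≡-Reasoning

  halves : ∀ δ → ½ ℚ.* δ ℚ.+ ½ ℚ.* δ ≡ δ
  halves δ = begin
    ½ ℚ.* δ ℚ.+ ½ ℚ.* δ ≡⟨ ℚ.*-distribʳ-+ δ ½ ½ ⟨
    1ℚ ℚ.* δ            ≡⟨ ℚ.*-identityˡ δ ⟩
    δ                   ∎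
    where open Eq.≡-Reasoning

  half-pos : ∀ δ → 0ℚ ℚ.< δ → 0ℚ ℚ.< ½ ℚ.* δ
  half-pos δ 0<δ = ℚ.positive⁻¹ _ {{ℚ.pos*pos⇒pos ½ δ {{ℚ.positive 0<δ}}}}

  split : ∀ a b → a ≡ (a ℚ.- b) ℚ.+ b
  split a b = begin-equality
    a                       ≡⟨ ℚ.+-identityʳ a ⟨
    a ℚ.+ 0ℚ                ≡⟨ Eq.cong (a ℚ.+_) (ℚ.+-inverseˡ b) ⟨
    a ℚ.+ (ℚ.- b ℚ.+ b)     ≡⟨ ℚ.+-assoc a (ℚ.- b) b ⟨
    (a ℚ.- b) ℚ.+ b         ∎
    where open ℚ.≤-Reasoning

  *-distribˡ-- : ∀ a b c → a ℚ.* (b ℚ.- c) ≡ a ℚ.* b ℚ.- a ℚ.* c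
  *-distribˡ-- a b c = begin-equality
    a ℚ.* (b ℚ.- c)             ≡⟨ ℚ.*-distribˡ-+ a b (ℚ.- c) ⟩
    a ℚ.* b ℚ.+ a ℚ.* (ℚ.- c)   ≡⟨ Eq.cong (λ u → a ℚ.* b ℚ.+ u) (ℚ.neg-distribʳ-* a c) ⟨
    a ℚ.* b ℚ.- a ℚ.* c         ∎
    where open ℚ.≤-Reasoning

  const-cauchy : ∀ q → IsCauchy (λ _ → q)
  const-cauchy q δ 0<δ =
    0 , λ _ _ _ _ → subst (ℚ._< δ) (sym (Eq.cong ℚ.∣_∣ (ℚ.+-inverseʳ q))) 0<δ

  +-cauchy : ∀ {x y} → IsCauchy x → IsCauchy y → IsCauchy (λ n → x n ℚ.+ y n)
  +-cauchy {x} {y} cx cy δ 0<δ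
    with cx (½ ℚ.* δ) (half-pos δ 0<δ) | cy (½ ℚ.* δ) (half-pos δ 0<δ)
  ... | M₁ , hx | M₂ , hy = M₁ ℕ.⊔ M₂ , close
    where
    rearrange : ∀ a b c d → (a ℚ.+ b) ℚ.- (c ℚ.+ d) ≡ (a ℚ.- c) ℚ.+ (b ℚ.- d)
    rearrange a b c d = begin-equality
      (a ℚ.+ b) ℚ.- (c ℚ.+ d)             ≡⟨ Eq.cong (λ z → (a ℚ.+ b) ℚ.+ z) (ℚ.neg-distrib-+ c d) ⟩
      (a ℚ.+ b) ℚ.+ (ℚ.- c ℚ.+ ℚ.- d)     ≡⟨ interchange a b (ℚ.- c) (ℚ.- d) ⟩
      (a ℚ.- c) ℚ.+ (b ℚ.- d)             ∎
      where open ℚ.≤-Reasoning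
    open ℚ.≤-Reasoning
    close : ∀ m n → M₁ ℕ.⊔ M₂ ℕ.≤ m → M₁ ℕ.⊔ M₂ ℕ.≤ n →
            ℚ.∣ (x m ℚ.+ y m) ℚ.- (x n ℚ.+ y n) ∣ ℚ.< δ
    close m n M≤m M≤n = begin-strict
      ℚ.∣ (x m ℚ.+ y m) ℚ.- (x n ℚ.+ y n) ∣
        ≡⟨ Eq.cong ℚ.∣_∣ (rearrange (x m) (y m) (x n) (y n)) ⟩
      ℚ.∣ (x m ℚ.- x n) ℚ.+ (y m ℚ.- y n) ∣
        ≤⟨ ℚ.∣p+q∣≤∣p∣+∣q∣ (x m ℚ.- x n) (y m ℚ.- y n) ⟩
      ℚ.∣ x m ℚ.- x n ∣ ℚ.+ ℚ.∣ y m ℚ.- y n ∣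
        <⟨ ℚ.+-mono-< (hx m n (ℕ.m⊔n≤o⇒m≤o M₁ M₂ M≤m) (ℕ.m⊔n≤o⇒m≤o M₁ M₂ M≤n))
                      (hy m n (ℕ.m⊔n≤o⇒n≤o M₁ M₂ M≤m) (ℕ.m⊔n≤o⇒n≤o M₁ M₂ M≤n)) ⟩
      ½ ℚ.* δ ℚ.+ ½ ℚ.* δ
        ≡⟨ halves δ ⟩
      δ ∎

  bounded : ∀ {x} → IsCauchy x →
            ∃[ B ] (0ℚ ℚ.< B × ∃[ M ] (∀ n → M ℕ.≤ n → ℚ.∣ x n ∣ ℚ.≤ B))
  bounded {x} cx with cx 1ℚ 0<1
  ... | M , h = 1ℚ ℚ.+ ℚ.∣ x M ∣ , ℚ.+-mono-<-≤ 0<1 (ℚ.0≤∣p∣ (x M)) , M , bound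
    where
    open ℚ.≤-Reasoning
    bound : ∀ n → M ℕ.≤ n → ℚ.∣ x n ∣ ℚ.≤ 1ℚ ℚ.+ ℚ.∣ x M ∣
    bound n M≤n = begin
      ℚ.∣ x n ∣                       ≡⟨ Eq.cong ℚ.∣_∣ (split (x n) (x M)) ⟩
      ℚ.∣ (x n ℚ.- x M) ℚ.+ x M ∣     ≤⟨ ℚ.∣p+q∣≤∣p∣+∣q∣ (x n ℚ.- x M) (x M) ⟩
      ℚ.∣ x n ℚ.- x M ∣ ℚ.+ ℚ.∣ x M ∣ ≤⟨ ℚ.+-monoˡ-≤ ℚ.∣ x M ∣ (ℚ.<⇒≤ (h n M M≤n ℕ.≤-refl)) ⟩
      1ℚ ℚ.+ ℚ.∣ x M ∣                ∎

  scaled : ∀ a b {A η ε} → 0ℚ ℚ.< A → ℚ.∣ a ∣ ℚ.≤ A → ℚ.∣ b ∣ ℚ.< η → A ℚ.* η ≡ ε →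
           ℚ.∣ a ℚ.* b ∣ ℚ.< ε
  scaled a b {A} {η} {ε} 0<A a≤A b<η Aη≡ε = begin-strict
    ℚ.∣ a ℚ.* b ∣         ≡⟨ ℚ.∣p*q∣≡∣p∣*∣q∣ a b ⟩
    ℚ.∣ a ∣ ℚ.* ℚ.∣ b ∣   ≤⟨ ℚ.*-monoʳ-≤-nonNeg ℚ.∣ b ∣ {{ℚ.nonNegative (ℚ.0≤∣p∣ b)}} a≤A ⟩
    A ℚ.* ℚ.∣ b ∣         <⟨ ℚ.*-monoʳ-<-pos A {{ℚ.positive 0<A}} b<η ⟩
    A ℚ.* η               ≡⟨ Aη≡ε ⟩
    ε                     ∎
    where open ℚ.≤-Reasoning

  *-cauchy : ∀ {x y} → IsCauchy x → IsCauchy y → IsCauchy (λ n → x n ℚ.* y n)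
  *-cauchy {x} {y} cx cy δ 0<δ
    with bounded cx | bounded cy
  ... | A , 0<A , K₁ , x≤A | B , 0<B , K₂ , y≤B
    with share A (½ ℚ.* δ) 0<A (half-pos δ 0<δ) | share B (½ ℚ.* δ) 0<B (half-pos δ 0<δ)
  ... | η , 0<η , Aη | θ , 0<θ , Bθ
    with cx θ 0<θ | cy η 0<η
  ... | M₁ , hx | M₂ , hy = (K₁ ℕ.⊔ K₂) ℕ.⊔ (M₁ ℕ.⊔ M₂) , close
    where
    rearrange : ∀ a b c d → (a ℚ.* b) ℚ.- (c ℚ.* d) ≡ a ℚ.* (b ℚ.- d) ℚ.+ d ℚ.* (a ℚ.- c)
    rearrange a b c d = begin-equality
      a ℚ.* b ℚ.- c ℚ.* d
        ≡⟨ Eq.cong₂ (λ u v → u ℚ.- v) (split (a ℚ.* b) (a ℚ.* d)) (ℚ.*-comm c d) ⟩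
      ((a ℚ.* b ℚ.- a ℚ.* d) ℚ.+ a ℚ.* d) ℚ.- d ℚ.* c
        ≡⟨ ℚ.+-assoc (a ℚ.* b ℚ.- a ℚ.* d) (a ℚ.* d) (ℚ.- (d ℚ.* c)) ⟩
      (a ℚ.* b ℚ.- a ℚ.* d) ℚ.+ (a ℚ.* d ℚ.- d ℚ.* c)
        ≡⟨ Eq.cong (λ u → (a ℚ.* b ℚ.- a ℚ.* d) ℚ.+ (u ℚ.- d ℚ.* c)) (ℚ.*-comm a d) ⟩
      (a ℚ.* b ℚ.- a ℚ.* d) ℚ.+ (d ℚ.* a ℚ.- d ℚ.* c)
        ≡⟨ Eq.cong₂ ℚ._+_ (*-distribˡ-- a b d) (*-distribˡ-- d a c) ⟨
      a ℚ.* (b ℚ.- d) ℚ.+ d ℚ.* (a ℚ.- c) ∎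
      where open ℚ.≤-Reasoning
    open ℚ.≤-Reasoning
    close : ∀ m n → (K₁ ℕ.⊔ K₂) ℕ.⊔ (M₁ ℕ.⊔ M₂) ℕ.≤ m → (K₁ ℕ.⊔ K₂) ℕ.⊔ (M₁ ℕ.⊔ M₂) ℕ.≤ n →
            ℚ.∣ (x m ℚ.* y m) ℚ.- (x n ℚ.* y n) ∣ ℚ.< δ
    close m n ≤m ≤n = begin-strict
      ℚ.∣ (x m ℚ.* y m) ℚ.- (x n ℚ.* y n) ∣
        ≡⟨ Eq.cong ℚ.∣_∣ (rearrange (x m) (y m) (x n) (y n)) ⟩
      ℚ.∣ x m ℚ.* (y m ℚ.- y n) ℚ.+ y n ℚ.* (x m ℚ.- x n) ∣
        ≤⟨ ℚ.∣p+q∣≤∣p∣+∣q∣ (x m ℚ.* (y m ℚ.- y n)) (y n ℚ.* (x m ℚ.- x n)) ⟩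
      ℚ.∣ x m ℚ.* (y m ℚ.- y n) ∣ ℚ.+ ℚ.∣ y n ℚ.* (x m ℚ.- x n) ∣
        <⟨ ℚ.+-mono-<
             (scaled (x m) (y m ℚ.- y n) 0<A (x≤A m (ℕ.m⊔n≤o⇒m≤o K₁ K₂ Km)) (hy m n M₂m M₂n) Aη)
             (scaled (y n) (x m ℚ.- x n) 0<B (y≤B n (ℕ.m⊔n≤o⇒n≤o K₁ K₂ Kn)) (hx m n M₁m M₁n) Bθ) ⟩
      ½ ℚ.* δ ℚ.+ ½ ℚ.* δ
        ≡⟨ halves δ ⟩
      δ ∎
      where
      Km  = ℕ.m⊔n≤o⇒m≤o (K₁ ℕ.⊔ K₂) (M₁ ℕ.⊔ M₂) ≤m
      Kn  = ℕ.m⊔n≤o⇒m≤o (K₁ ℕ.⊔ K₂) (M₁ ℕ.⊔ M₂) ≤n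
      Mm  = ℕ.m⊔n≤o⇒n≤o (K₁ ℕ.⊔ K₂) (M₁ ℕ.⊔ M₂) ≤m
      Mn  = ℕ.m⊔n≤o⇒n≤o (K₁ ℕ.⊔ K₂) (M₁ ℕ.⊔ M₂) ≤n
      M₁m = ℕ.m⊔n≤o⇒m≤o M₁ M₂ Mm
      M₁n = ℕ.m⊔n≤o⇒m≤o M₁ M₂ Mn
      M₂m = ℕ.m⊔n≤o⇒n≤o M₁ M₂ Mm
      M₂n = ℕ.m⊔n≤o⇒n≤o M₁ M₂ Mn

infixl 6 _+ℝ_
infixl 7 _*ℝ_

fromℚ : ℚ → ℝ
fromℚ q = mkℝ (λ _ → q) (const-cauchy q)

fromℕ : ℕ → ℝ
fromℕ k = fromℚ (+ k ℚ./ 1)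

0ℝ 1ℝ : ℝ
0ℝ = fromℚ 0ℚ
1ℝ = fromℚ 1ℚ

_+ℝ_ : ℝ → ℝ → ℝ
x +ℝ y = mkℝ (λ n → seq x n ℚ.+ seq y n) (+-cauchy {seq x} {seq y} (cauchy x) (cauchy y))

_*ℝ_ : ℝ → ℝ → ℝ
x *ℝ y = mkℝ (λ n → seq x n ℚ.* seq y n) (*-cauchy {seq x} {seq y} (cauchy x) (cauchy y))

∑ : {A : Set} → List A → (A → ℝ) → ℝ
∑ xs f = foldr _+ℝ_ 0ℝ (map f xs)

------------------------------------------------------------------------
-- The tower of exponentials is a real number given by its lower Dedekind
-- cut: a cut L denotes the supremum of the rationals q with L q.

Cut : Set₁
Cut = ℚ → Set

-- For b > 0, the cut of the quotient a / b: q < a / b iff q b < a.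
_÷_ : ℝ → ℝ → Cut
(a ÷ b) q = fromℚ q *ℝ b <ℝ a

2^ℤ_ : ℤ → ℚ
2^ℤ (+ k)    = (+ 2 ℚ./ 1) ^ℚ k
2^ℤ -[1+ k ] = ½ ^ℚ suc k

-- q < 2 ^ (s / d), for the rational s / d in lowest terms, is decided by
-- comparing d-th powers when q is nonnegative, and always holds otherwise.
_<2^_ : ℚ → ℚ → Set
q <2^ r = 0ℚ ℚ.≤ q → q ^ℚ ℚ.↧ₙ r ℚ.< 2^ℤ (ℚ.↥ r)

-- 2 ^ x is the supremum of 2 ^ r over the rationals r < x.
exp₂ : Cut → Cut
exp₂ L q = ∃[ r ] (L r × q <2^ r)

tower : ℕ → Cut → Cut
tower zero    L = L
tower (suc k) L = exp₂ (tower k L)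

_≤ℕ_ : Cut → ℕ → Set
L ≤ℕ N = ∀ q → L q → q ℚ.≤ + N ℚ./ 1

------------------------------------------------------------------------
-- Finite probability

-- A probability distribution on the elements of a repetition-free list;
-- the values of `weight` outside the list are irrelevant.
record Distribution {A : Set} (outcomes : List A) : Set where
  field
    weight      : A → ℝ
    nonnegative : ∀ {a} → a List.∈ outcomes → 0ℝ ≤ℝ weight a
    total       : ∑ outcomes weight ≈ℝ 1ℝ

open Distribution public

vectors : {A : Set} → List A → (k : ℕ) → List (Vec A k)
vectors xs zero    = [ [] ]
vectors xs (suc k) = cartesianProductWith _∷_ xs (vectors xs k)

------------------------------------------------------------------------
-- The die guessing game.  Fin N, with its order, stands for {1, …, N}.

subsetsOfSize : (n N : ℕ) → List (Subset N)
subsetsOfSize n N = filter (λ S → ∣ S ∣ ℕ.≟ n) (vectors (inside ∷ outside ∷ []) N)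

-- The rolled die: the numbers on the visible faces, in the order in which
-- they are shown, and the number on the hidden face.
Roll : (n N : ℕ) → Set
Roll n N = Vec (Fin N) (pred n) × Fin N

IsRollOf : ∀ {n N} → Subset N → Roll n N → Set
IsRollOf S (v , h) = Unique (h ∷ v) × All (_∈ S) (h ∷ v)

isRollOf? : ∀ {n N} (S : Subset N) (ρ : Roll n N) → Dec (IsRollOf {n} S ρ)
isRollOf? S (v , h) = allPairs? (λ i j → ¬? (i Fin.≟ j)) (h ∷ v) ×-dec All.all? (_∈? S) (h ∷ v)

-- If n ≥ 1 and S has n elements, these are the n! arrangements of S on the
-- faces.
rolls : ∀ n {N} → Subset N → List (Roll n N)
rolls n {N} S =
  filter (isRollOf? {n} S) (cartesianProduct (vectors (allFin N) (pred n)) (allFin N))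

-- Ranks are counted from 0 rather than from 1, so that they match Fin n.
hiddenRank : ∀ {n N} → Roll n N → ℕ
hiddenRank (v , h) = Vec.count (Fin._<? h) v

-- A randomized cardinal algorithm.
Algorithm : (n N : ℕ) → Set
Algorithm n N = Vec (Fin N) (pred n) → Distribution (allFin n)

reward : ∀ {n N} → Roll n N → Fin n → ℝ
reward {n} ρ guess = if does (toℕ guess ℕ.≟ hiddenRank {n} ρ) then 1ℝ else 0ℝ

rewardOnRoll : ∀ {n N} → Algorithm n N → Roll n N → ℝ
rewardOnRoll {n} A ρ@(v , _) = ∑ (allFin n) (λ g → weight (A v) g *ℝ reward {n} ρ g)

-- The composition of the two uniformly random permutations (numbering the
-- faces, then rolling) is uniform, so each arrangement has probability 1/n!.
rewardOnSet : ∀ {n N} → Algorithm n N → Subset N → ℝ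
rewardOnSet {n} A S = fromℚ ((+ 1 ℚ./ (n !)) {{n ℕ.!≢0}}) *ℝ ∑ (rolls n S) (rewardOnRoll A)

expectedReward : ∀ {n N} → Distribution (subsetsOfSize n N) → Algorithm n N → ℝ
expectedReward {n} {N} F A = ∑ (subsetsOfSize n N) (λ S → weight F S *ℝ rewardOnSet A S)

-- Some distribution keeps every algorithm's expected reward at or below
-- (1 + ε) / n, that is, (1 + ε) times the optimal ordinal reward 1 / n.
Hard : (n : ℕ) (ε : ℝ) (N : ℕ) → Set
Hard n ε N =
  Σ[ F ∈ Distribution (subsetsOfSize n N) ]
    (∀ (A : Algorithm n N) → fromℕ n *ℝ expectedReward F A ≤ℝ 1ℝ +ℝ ε)

-- The cardinal complexity is the least N with Hard n ε N; it is at least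
-- the real denoted by T iff every such N is.
CardinalComplexityAtLeast : (n : ℕ) (ε : ℝ) (T : Cut) → Set
CardinalComplexityAtLeast n ε T = ∀ N → Hard n ε N → T ≤ℕ N

{-# OPTIONS --safe #-}

-- An algorithm is encoded by the excess q(T, i), in units of 1/(nB), of its
-- probability of guessing rank i on seeing the set T over 1/n.  Excesses sum to
-- zero over i, and on S = {s₀ < … < sₖ} they earn Σᵢ q(S ∖ sᵢ, i).  So one integer
-- rule with |q| ≤ B that earns at least 1 on every S gains a factor 1 + 1/(nB),
-- whatever the distribution of S.  For two faces q = (x, -x) is such a rule.
-- To go from numbers below L and k visible faces to numbers below 2 ^ L and k + 1
-- visible faces, replace T by its gap levels, the highest binary digits in which
-- neighbours differ: removing a point of S merges two adjacent levels into their
-- maximum.  On a monotone sequence of levels this removes an element from a set of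
-- levels, so the previous rule applies.  A large multiple of a local rule, which
-- loses nothing on monotone sequences and earns at each change of direction, takes
-- care of all others.  Each step costs a factor polynomial in n, so that
-- N ≤ tower(K) gives a gain of at least 1 / (K (6n) ^ (7n)).

module Submission where

import Algebra.Definitions.RawSemiring
open import Data.Bool.Base using (Bool; true; false; T; _∧_; if_then_else_)
open import Data.Bool.Properties using (T-∧; T?)
open import Data.Fin.Base as Fin using (Fin; zero; suc; toℕ)
import Data.Fin.Properties as Fin
open import Data.Fin.Subset using (Subset; inside; outside; ∣_∣; _∈_)
open import Data.Integer.Base as ℤ using (ℤ; +_; -[1+_]; 0ℤ; 1ℤ; -1ℤ)
import Data.Integer.Properties as ℤ
open import Data.Integer.Tactic.RingSolver using (solve-∀)
open import Data.List.Base using (List; []; _∷_; _++_; length; map; filter; foldr; allFin; cartesianProduct; cartesianProductWith)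
open import Data.List.Membership.Propositional using () renaming (_∈_ to _∈ˡ_)
open import Data.List.Membership.Propositional.Properties using (∈-filter⁻)
open import Data.List.Properties using (length-map; map-tabulate)
open import Data.List.Relation.Unary.All as All using (All; []; _∷_)
open import Data.List.Relation.Unary.All.Properties using (map⁺)
open import Data.List.Relation.Unary.Any using (here; there)
open import Data.List.Relation.Unary.Linked using (Linked; []; [-]; _∷_; linked?)
open import Data.Nat.Base as ℕ using (ℕ; zero; suc; _+_; _*_; _^_; _∸_; _⊔_; _⊓_; _≤_; _<_; _>_; _<ᵇ_; z≤n; s≤s; z<s; s<s; _!)
import Data.Nat.Properties as ℕ
open import Data.Nat.Tactic.RingSolver using () renaming (solve-∀ to ℕ-solve-∀)
open import Data.Product.Base using (∃-syntax; _×_; _,_; proj₁; proj₂)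
open import Data.Rational.Base as ℚ using (ℚ; 0ℚ; 1ℚ; ½)
import Data.Rational.Properties as ℚ
open import Data.Rational.Solver using (module +-*-Solver)
open import Data.Rational.Unnormalised.Base as ℚᵘ using (mkℚᵘ; *≡*; *≤*)
import Data.Rational.Unnormalised.Properties as ℚᵘ
open import Data.Sum.Base as Sum using (_⊎_; inj₁; inj₂)
open import Data.Vec.Base as Vec using (Vec; []; _∷_; lookup; _[_]≔_)
import Data.Vec.Properties as Vec
open import Data.Vec.Relation.Unary.All as VecAll using ([]; _∷_)
open import Data.Vec.Relation.Unary.AllPairs using ([]; _∷_)
open import Data.Vec.Relation.Unary.Unique.Propositional using (Unique)
open import Defs
open import Function.Base using (_∘_)
open import Function.Bundles using (Equivalence; mk⇔)
open import Relation.Binary.Definitions using (tri<; tri≈; tri>)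
open import Relation.Binary.PropositionalEquality using (_≡_; _≢_; refl; sym; trans; cong; cong₂; subst; module ≡-Reasoning)
open import Relation.Nullary.Decidable using (does; dec-true; dec-false; does-⇔; toWitness; yes; no)
open import Relation.Nullary.Negation using (¬_; contradiction)
open import Relation.Unary using (Decidable)
open import Data.List.Sort.InsertionSort.Base ℕ.≤-decTotalOrder using (insert; sort)

open Algebra.Definitions.RawSemiring ℚ.+-*-rawSemiring using () renaming (_^_ to _^ℚ_)

-- Finite sums of integers

Σ< : ℕ → (ℕ → ℤ) → ℤ
Σ< zero    f = 0ℤ
Σ< (suc n) f = f 0 ℤ.+ Σ< n (f ∘ suc)

Σ<-cong : ∀ n {f g} → (∀ i → f i ≡ g i) → Σ< n f ≡ Σ< n g
Σ<-cong zero    eq = refl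
Σ<-cong (suc n) eq = cong₂ ℤ._+_ (eq 0) (Σ<-cong n (eq ∘ suc))

Σ<-zero : ∀ n {f} → (∀ i → f i ≡ 0ℤ) → Σ< n f ≡ 0ℤ
Σ<-zero zero    eq = refl
Σ<-zero (suc n) eq = cong₂ ℤ._+_ (eq 0) (Σ<-zero n (eq ∘ suc))

Σ<-+ : ∀ n f g → Σ< n (λ i → f i ℤ.+ g i) ≡ Σ< n f ℤ.+ Σ< n g
Σ<-+ zero    f g = refl
Σ<-+ (suc n) f g =
  trans (cong (λ z → (f 0 ℤ.+ g 0) ℤ.+ z) (Σ<-+ n (f ∘ suc) (g ∘ suc)))
        (shuffle (f 0) (g 0) (Σ< n (f ∘ suc)) (Σ< n (g ∘ suc)))
  where
  shuffle : ∀ a b c d → a ℤ.+ b ℤ.+ (c ℤ.+ d) ≡ a ℤ.+ c ℤ.+ (b ℤ.+ d)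
  shuffle = solve-∀

Σ<-* : ∀ n c f → Σ< n (λ i → c ℤ.* f i) ≡ c ℤ.* Σ< n f
Σ<-* zero    c f = sym (ℤ.*-zeroʳ c)
Σ<-* (suc n) c f =
  trans (cong (λ z → c ℤ.* f 0 ℤ.+ z) (Σ<-* n c (f ∘ suc))) (sym (ℤ.*-distribˡ-+ c _ _))

Σ<-bound : ∀ n {f B} → (∀ i → ℤ.∣ f i ∣ ≤ B) → ℤ.∣ Σ< n f ∣ ≤ n * B
Σ<-bound zero        le = z≤n
Σ<-bound (suc n) {f} le =
  ℕ.≤-trans (ℤ.∣i+j∣≤∣i∣+∣j∣ (f 0) _) (ℕ.+-mono-≤ (le 0) (Σ<-bound n (le ∘ suc)))

when : Bool → ℤ → ℤ
when b z = if b then z else 0ℤ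

when-bound : ∀ b {z B} → ℤ.∣ z ∣ ≤ B → ℤ.∣ when b z ∣ ≤ B
when-bound true  le = le
when-bound false le = z≤n

when-zero : ∀ b → when b 0ℤ ≡ 0ℤ
when-zero true  = refl
when-zero false = refl

Σ<-when : ∀ b n f → Σ< n (λ i → when b (f i)) ≡ when b (Σ< n f)
Σ<-when true  n f = refl
Σ<-when false n f = Σ<-zero n (λ _ → refl)

Σ<-truncate : ∀ m f → Σ< (suc m) (λ i → when (i <ᵇ m) (f i)) ≡ Σ< m f
Σ<-truncate zero    f = refl
Σ<-truncate (suc m) f = cong (λ z → f 0 ℤ.+ z) (Σ<-truncate m (f ∘ suc))

when-cong : ∀ b {x y} → (b ≡ true → x ≡ y) → when b x ≡ when b y
when-cong true  eq = eq refl
when-cong false eq = refl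

-- Increasing lists and their gap levels

Increasing Decreasing : List ℕ → Set
Increasing = Linked _<_
Decreasing = Linked _>_

increasing? = linked? ℕ._<?_
decreasing? = linked? ℕ._>?_

remove : {A : Set} → ℕ → List A → List A
remove i       []       = []
remove zero    (x ∷ xs) = xs
remove (suc i) (x ∷ xs) = x ∷ remove i xs

-- The effect on the gap levels of removing a point: the two gaps next to it
-- merge into one, whose level is the larger of the two.
contract : ℕ → List ℕ → List ℕ
contract i             []           = []
contract zero          (d ∷ ds)     = ds
contract (suc zero)    (d ∷ [])     = []
contract (suc zero)    (d ∷ e ∷ ds) = d ⊔ e ∷ ds
contract (suc (suc i)) (d ∷ ds)     = d ∷ contract (suc i) ds

-- For x < y < 2 ^ L: the most significant binary digit in which they differ.
level : ℕ → ℕ → ℕ → ℕ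
level zero    x y = 0
level (suc L) x y =
  if does (y ℕ.<? 2 ^ L) then level L x y else
  if does (x ℕ.<? 2 ^ L) then L else level L (x ∸ 2 ^ L) (y ∸ 2 ^ L)

gaps : ℕ → List ℕ → List ℕ
gaps L []           = []
gaps L (x ∷ [])     = []
gaps L (x ∷ y ∷ xs) = level L x y ∷ gaps L (y ∷ xs)

level-low : ∀ L {x y} → y < 2 ^ L → level (suc L) x y ≡ level L x y
level-low L {x} {y} y< rewrite dec-true (y ℕ.<? 2 ^ L) y< = refl

level-cross : ∀ L {x y} → x < 2 ^ L → 2 ^ L ≤ y → level (suc L) x y ≡ L
level-cross L {x} {y} x< ≤y
  rewrite dec-false (y ℕ.<? 2 ^ L) (ℕ.≤⇒≯ ≤y) | dec-true (x ℕ.<? 2 ^ L) x< = refl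

level-high : ∀ L {x y} → 2 ^ L ≤ x → 2 ^ L ≤ y →
             level (suc L) x y ≡ level L (x ∸ 2 ^ L) (y ∸ 2 ^ L)
level-high L {x} {y} ≤x ≤y
  rewrite dec-false (y ℕ.<? 2 ^ L) (ℕ.≤⇒≯ ≤y) | dec-false (x ℕ.<? 2 ^ L) (ℕ.≤⇒≯ ≤x) = refl

high-< : ∀ L {y} → 2 ^ L ≤ y → y < 2 ^ suc L → y ∸ 2 ^ L < 2 ^ L
high-< L {y} ≤y y< =
  subst (y ∸ 2 ^ L <_) (trans (ℕ.m+n∸m≡n (2 ^ L) _) (ℕ.+-identityʳ (2 ^ L))) (ℕ.∸-monoˡ-< y< ≤y)

level-< : ∀ L {x y} → x < y → y < 2 ^ L → level L x y < L
level-< zero x<y (s≤s z≤n) = contradiction x<y ℕ.n≮0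
level-< (suc L) {x} {y} x<y y< with y ℕ.<? 2 ^ L | x ℕ.<? 2 ^ L
... | yes y<L | _       =
  subst (_< suc L) (sym (level-low L y<L)) (ℕ.m≤n⇒m≤1+n (level-< L x<y y<L))
... | no  y≮L | yes x<L =
  subst (_< suc L) (sym (level-cross L x<L (ℕ.≮⇒≥ y≮L))) (ℕ.n<1+n L)
... | no  y≮L | no  x≮L =
  subst (_< suc L) (sym (level-high L (ℕ.≮⇒≥ x≮L) (ℕ.≮⇒≥ y≮L)))
    (ℕ.m≤n⇒m≤1+n (level-< L (ℕ.∸-monoˡ-< x<y (ℕ.≮⇒≥ x≮L)) (high-< L (ℕ.≮⇒≥ y≮L) y<)))

-- At the top digit where `x` and `z` differ, `x` has 0 and `z` has 1, and `y` sides with one of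
-- them. The pair separated by this digit has the level of `x` and `z`; the other pair agrees there
-- and above, so its level is strictly smaller. This is the standard fact behind stepping-up
-- arguments in Ramsey theory.
level-triple : ∀ L {x y z} → x < y → y < z → z < 2 ^ L →
               level L x z ≡ level L x y ⊔ level L y z × level L x y ≢ level L y z
level-triple zero x<y y<z (s≤s z≤n) = contradiction y<z ℕ.n≮0
level-triple (suc L) {x} {y} {z} x<y y<z z< with z ℕ.<? 2 ^ L | y ℕ.<? 2 ^ L | x ℕ.<? 2 ^ L
... | yes z<L | _ | _
  rewrite level-low L {x} z<L | level-low L {y} z<L | level-low L {x} (ℕ.<-trans y<z z<L) =
  level-triple L x<y y<z z<L
... | no z≮L | yes y<L | _
  rewrite level-cross L (ℕ.<-trans x<y y<L) (ℕ.≮⇒≥ z≮L) | level-cross L y<L (ℕ.≮⇒≥ z≮L) | level-low L {x} y<L =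
  sym (ℕ.m≤n⇒m⊔n≡n (ℕ.<⇒≤ (level-< L x<y y<L))) , ℕ.<⇒≢ (level-< L x<y y<L)
... | no z≮L | no y≮L | yes x<L
  rewrite level-cross L x<L (ℕ.≮⇒≥ z≮L) | level-cross L x<L (ℕ.≮⇒≥ y≮L) | level-high L (ℕ.≮⇒≥ y≮L) (ℕ.≮⇒≥ z≮L) =
  let yz< = level-< L (ℕ.∸-monoˡ-< y<z (ℕ.≮⇒≥ y≮L)) (high-< L (ℕ.≮⇒≥ z≮L) z<)
  in sym (ℕ.m≥n⇒m⊔n≡m (ℕ.<⇒≤ yz<)) , ℕ.>⇒≢ yz<
... | no z≮L | no y≮L | no x≮L
  rewrite level-high L (ℕ.≮⇒≥ x≮L) (ℕ.≮⇒≥ z≮L) | level-high L (ℕ.≮⇒≥ x≮L) (ℕ.≮⇒≥ y≮L) | level-high L (ℕ.≮⇒≥ y≮L) (ℕ.≮⇒≥ z≮L) =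
  level-triple L (ℕ.∸-monoˡ-< x<y (ℕ.≮⇒≥ x≮L)) (ℕ.∸-monoˡ-< y<z (ℕ.≮⇒≥ y≮L)) (high-< L (ℕ.≮⇒≥ z≮L) z<)

length-gaps : ∀ L x xs → length (gaps L (x ∷ xs)) ≡ length xs
length-gaps L x []       = refl
length-gaps L x (y ∷ xs) = cong suc (length-gaps L y xs)

-- Removing an end point just drops the outer gap. Removing an inner point joins two gaps, and
-- `level-triple` gives the level of the joined gap as their maximum.
gaps-remove : ∀ L i S → Increasing S → All (_< 2 ^ L) S →
              gaps L (remove i S) ≡ contract i (gaps L S)
gaps-remove L i             []               inc             bd = refl
gaps-remove L zero          (x ∷ [])         inc             bd = refl
gaps-remove L (suc i)       (x ∷ [])         inc             bd = refl
gaps-remove L zero          (x ∷ y ∷ xs)     inc             bd = refl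
gaps-remove L (suc zero)    (x ∷ y ∷ [])     inc             bd = refl
gaps-remove L (suc zero)    (x ∷ y ∷ z ∷ xs) (x<y ∷ y<z ∷ _) (_ ∷ _ ∷ z< ∷ _) =
  cong (_∷ gaps L (z ∷ xs)) (proj₁ (level-triple L x<y y<z z<))
gaps-remove L (suc (suc i)) (x ∷ y ∷ xs)     (_ ∷ inc)       (_ ∷ bd) =
  cong (level L x y ∷_) (gaps-remove L (suc i) (y ∷ xs) inc bd)

-- This excludes plateaus: any three consecutive levels rise, fall or bend, as `turn` requires.
gaps-distinct : ∀ L S → Increasing S → All (_< 2 ^ L) S → Linked _≢_ (gaps L S)
gaps-distinct L []               inc               bd              = []
gaps-distinct L (x ∷ [])         inc               bd              = []
gaps-distinct L (x ∷ y ∷ [])     inc               bd              = [-]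
gaps-distinct L (x ∷ y ∷ z ∷ xs) (x<y ∷ y<z ∷ inc) (_ ∷ y< ∷ z< ∷ bd) =
  proj₂ (level-triple L x<y y<z z<) ∷ gaps-distinct L (y ∷ z ∷ xs) (y<z ∷ inc) (y< ∷ z< ∷ bd)

gaps-< : ∀ L S → Increasing S → All (_< 2 ^ L) S → All (_< L) (gaps L S)
gaps-< L []           inc         bd            = []
gaps-< L (x ∷ [])     inc         bd            = []
gaps-< L (x ∷ y ∷ xs) (x<y ∷ inc) (_ ∷ y< ∷ bd) =
  level-< L x<y y< ∷ gaps-< L (y ∷ xs) inc (y< ∷ bd)

-- A local correction

-- A tie counts as a descent. In a `bend` with distinct neighbours, a tie can occur only between the
-- two outer levels of a dip, where its sign cancels.
sgn< : ℕ → ℕ → ℤ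
sgn< a b = if does (a ℕ.<? b) then 1ℤ else -1ℤ

sgn<-up : ∀ {a b} → a < b → sgn< a b ≡ 1ℤ
sgn<-up {a} {b} a<b rewrite dec-true (a ℕ.<? b) a<b = refl

sgn<-down : ∀ {a b} → b ≤ a → sgn< a b ≡ -1ℤ
sgn<-down {a} {b} b≤a rewrite dec-false (a ℕ.<? b) (ℕ.≤⇒≯ b≤a) = refl

∣sgn<∣ : ∀ a b → ℤ.∣ sgn< a b ∣ ≡ 1
∣sgn<∣ a b with does (a ℕ.<? b)
... | true  = refl
... | false = refl

-- The weights 1, -2, 2, -1 are a solution, for two gaps, of the system asking
-- for zero sum, no loss on monotone triples of levels and a gain on the others.
stencil : ℕ → ℤ
stencil 0 = 1ℤ
stencil 1 = -[1+ 1 ]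
stencil 2 = + 2
stencil 3 = -1ℤ
stencil _ = 0ℤ

shift : (ℕ → ℤ) → ℕ → ℤ
shift f zero    = 0ℤ
shift f (suc i) = f i

-- Unfolded, this is the convolution of the sequence of ascent and descent signs with `stencil`.
ripple : List ℕ → ℕ → ℤ
ripple []           i = 0ℤ
ripple (d ∷ [])     i = 0ℤ
ripple (d ∷ e ∷ ds) i = sgn< d e ℤ.* stencil i ℤ.+ shift (ripple (e ∷ ds)) i

-- The partial sums of the absolute values 1, 2, 2, 1 of `stencil`.
stencil-prefix : ℕ → ℕ
stencil-prefix 0 = 1
stencil-prefix 1 = 3
stencil-prefix 2 = 5
stencil-prefix _ = 6

-- Stated with a bound that depends on `i`, so that the induction closes: the first pair adds the
-- size of `stencil i`, and the remaining pairs are seen at position `i - 1`. A uniform bound would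
-- grow with the list.
ripple-prefix : ∀ D i → ℤ.∣ ripple D i ∣ ≤ stencil-prefix i
ripple-prefix []           i = z≤n
ripple-prefix (d ∷ [])     i = z≤n
ripple-prefix (d ∷ e ∷ ds) i = begin
  ℤ.∣ sgn< d e ℤ.* stencil i ℤ.+ shift (ripple (e ∷ ds)) i ∣
    ≤⟨ ℤ.∣i+j∣≤∣i∣+∣j∣ (sgn< d e ℤ.* stencil i) _ ⟩
  ℤ.∣ sgn< d e ℤ.* stencil i ∣ + ℤ.∣ shift (ripple (e ∷ ds)) i ∣
    ≡⟨ cong (_+ ℤ.∣ shift (ripple (e ∷ ds)) i ∣) (ℤ.∣i*j∣≡∣i∣*∣j∣ (sgn< d e) (stencil i)) ⟩
  ℤ.∣ sgn< d e ∣ * ℤ.∣ stencil i ∣ + ℤ.∣ shift (ripple (e ∷ ds)) i ∣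
    ≡⟨ cong (λ s → s * ℤ.∣ stencil i ∣ + ℤ.∣ shift (ripple (e ∷ ds)) i ∣) (∣sgn<∣ d e) ⟩
  1 * ℤ.∣ stencil i ∣ + ℤ.∣ shift (ripple (e ∷ ds)) i ∣
    ≤⟨ add i (ripple-prefix (e ∷ ds)) ⟩
  stencil-prefix i ∎
  where
  open ℕ.≤-Reasoning
  add : ∀ i {f} → (∀ j → ℤ.∣ f j ∣ ≤ stencil-prefix j) →
        1 * ℤ.∣ stencil i ∣ + ℤ.∣ shift f i ∣ ≤ stencil-prefix i
  add 0 le = s≤s z≤n
  add 1 le = ℕ.+-monoʳ-≤ 2 (le 0)
  add 2 le = ℕ.+-monoʳ-≤ 2 (le 1)
  add 3 le = ℕ.+-monoʳ-≤ 1 (le 2)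
  add (suc (suc (suc (suc i)))) le = le (suc (suc (suc i)))

ripple-bound : ∀ D i → ℤ.∣ ripple D i ∣ ≤ 6
ripple-bound D i = ℕ.≤-trans (ripple-prefix D i) (prefix≤6 i)
  where
  prefix≤6 : ∀ i → stencil-prefix i ≤ 6
  prefix≤6 0 = s≤s z≤n
  prefix≤6 1 = s≤s (s≤s (s≤s z≤n))
  prefix≤6 2 = s≤s (s≤s (s≤s (s≤s (s≤s z≤n))))
  prefix≤6 (suc (suc (suc i))) = ℕ.≤-refl

-- The weights of `stencil` sum to zero, and the range is long enough to contain every translate of
-- it entirely.
ripple-balanced : ∀ D → Σ< (2 + length D) (ripple D) ≡ 0ℤ
ripple-balanced []           = refl
ripple-balanced (d ∷ [])     = refl
ripple-balanced (d ∷ e ∷ ds) = begin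
  Σ< n (λ i → sgn< d e ℤ.* stencil i ℤ.+ shift f i)  ≡⟨ Σ<-+ n (λ i → sgn< d e ℤ.* stencil i) (shift f) ⟩
  Σ< n (λ i → sgn< d e ℤ.* stencil i) ℤ.+ Σ< n (shift f)
    ≡⟨ cong₂ ℤ._+_ (Σ<-* n (sgn< d e) stencil) (ℤ.+-identityˡ _) ⟩
  sgn< d e ℤ.* Σ< n stencil ℤ.+ Σ< (2 + length (e ∷ ds)) f
    ≡⟨ cong₂ (λ x y → sgn< d e ℤ.* x ℤ.+ y) stencil-balanced (ripple-balanced (e ∷ ds)) ⟩
  sgn< d e ℤ.* 0ℤ ℤ.+ 0ℤ                             ≡⟨ cong (ℤ._+ 0ℤ) (ℤ.*-zeroʳ (sgn< d e)) ⟩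
  0ℤ ∎
  where
  open ≡-Reasoning
  n = 4 + length ds
  f = ripple (e ∷ ds)
  stencil-balanced : Σ< n stencil ≡ 0ℤ
  stencil-balanced rewrite Σ<-zero (length ds) {λ _ → 0ℤ} (λ _ → refl) = refl

-- If `D` lists the gap levels of a set, then `contract i D` lists those of the set without its
-- `i`-th point, so this is what a rule reading only gap levels earns on the set.
earned : (List ℕ → ℕ → ℤ) → List ℕ → ℤ
earned f D = Σ< (suc (length D)) (λ i → f (contract i D) i)

-- What `ripple` earns on the three gaps a, b, c: removing each of the four points in turn leaves
-- the pairs (b, c), (a ⊔ b, c), (a, b ⊔ c) and (a, b), whose signs are weighted by `stencil`.
bend : ℕ → ℕ → ℕ → ℤ
bend a b c =
  sgn< b c ℤ.+ -[1+ 1 ] ℤ.* sgn< (a ⊔ b) c ℤ.+ + 2 ℤ.* sgn< a (b ⊔ c) ℤ.+ -1ℤ ℤ.* sgn< a b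

-- The leading sign carries weight only for the first four removals, and these make up the bend. The
-- other signs are shifted by one, and so are the removals they see, hence they add up to what the
-- tail earns.
ripple-earned : ∀ a b c ds →
  earned ripple (a ∷ b ∷ c ∷ ds) ≡ bend a b c ℤ.+ earned ripple (b ∷ c ∷ ds)
ripple-earned a b c ds = begin
  earned ripple (a ∷ b ∷ c ∷ ds)
    ≡⟨ cong (λ z → f₀ ℤ.+ (f₁ ℤ.+ (f₂ ℤ.+ (f₃ ℤ.+ z)))) (Σ<-cong (length ds) (λ i → far (sgn< a b) _)) ⟩
  f₀ ℤ.+ (f₁ ℤ.+ (f₂ ℤ.+ (f₃ ℤ.+ w)))
    ≡⟨ collect (sgn< b c) (sgn< (a ⊔ b) c) (sgn< a (b ⊔ c)) (sgn< a b) x y z w ⟩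
  bend a b c ℤ.+ earned ripple (b ∷ c ∷ ds) ∎
  where
  open ≡-Reasoning
  x = ripple (c ∷ ds) 0
  y = ripple (b ⊔ c ∷ ds) 1
  z = ripple (b ∷ contract 1 (c ∷ ds)) 2
  w = Σ< (length ds) (λ i → ripple (b ∷ contract (2 + i) (c ∷ ds)) (3 + i))
  f₀ = sgn< b c ℤ.* 1ℤ ℤ.+ 0ℤ
  f₁ = sgn< (a ⊔ b) c ℤ.* -[1+ 1 ] ℤ.+ x
  f₂ = sgn< a (b ⊔ c) ℤ.* + 2 ℤ.+ y
  f₃ = sgn< a b ℤ.* -1ℤ ℤ.+ z
  far : ∀ s t → s ℤ.* 0ℤ ℤ.+ t ≡ t
  far = solve-∀
  collect : ∀ s₁ s₂ s₃ s₄ x y z w →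
    (s₁ ℤ.* 1ℤ ℤ.+ 0ℤ) ℤ.+ ((s₂ ℤ.* -[1+ 1 ] ℤ.+ x) ℤ.+ ((s₃ ℤ.* + 2 ℤ.+ y) ℤ.+ ((s₄ ℤ.* -1ℤ ℤ.+ z) ℤ.+ w)))
    ≡ (s₁ ℤ.+ -[1+ 1 ] ℤ.* s₂ ℤ.+ + 2 ℤ.* s₃ ℤ.+ -1ℤ ℤ.* s₄) ℤ.+ (x ℤ.+ (y ℤ.+ (z ℤ.+ w)))
  collect = solve-∀

-- All four signs agree, and the weights sum to zero.
bend-up-up : ∀ {a b c} → a < b → b < c → bend a b c ≡ 0ℤ
bend-up-up {a} {b} {c} a<b b<c
  rewrite sgn<-up b<c | sgn<-up (ℕ.⊔-pres-<m (ℕ.<-trans a<b b<c) b<c)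
        | sgn<-up (ℕ.<-≤-trans a<b (ℕ.m≤m⊔n b c)) | sgn<-up a<b = refl

bend-down-down : ∀ {a b c} → b < a → c < b → bend a b c ≡ 0ℤ
bend-down-down {a} {b} {c} b<a c<b
  rewrite sgn<-down (ℕ.<⇒≤ c<b) | sgn<-down (ℕ.≤-trans (ℕ.<⇒≤ c<b) (ℕ.m≤n⊔m a b))
        | sgn<-down (ℕ.<⇒≤ (ℕ.⊔-pres-<m b<a (ℕ.<-trans c<b b<a))) | sgn<-down (ℕ.<⇒≤ b<a) = refl

-- At a peak both maxima equal `b`, so the signs are -1, -1, 1, 1, and -1 + 2 + 2 - 1 = 2.
bend-up-down : ∀ {a b c} → a < b → c < b → bend a b c ≡ + 2
bend-up-down {a} {b} {c} a<b c<b
  rewrite sgn<-down (ℕ.<⇒≤ c<b) | sgn<-down (ℕ.≤-trans (ℕ.<⇒≤ c<b) (ℕ.m≤n⊔m a b))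
        | sgn<-up (ℕ.<-≤-trans a<b (ℕ.m≤m⊔n b c)) | sgn<-up a<b = refl

-- In a dip the two middle signs both compare `a` with `c` and cancel, whatever their value; the
-- outer signs 1 and -1 contribute 1 each.
bend-down-up : ∀ {a b c} → b < a → b < c → bend a b c ≡ + 2
bend-down-up {a} {b} {c} b<a b<c
  rewrite sgn<-up b<c | sgn<-down (ℕ.<⇒≤ b<a) | ℕ.m≥n⇒m⊔n≡m (ℕ.<⇒≤ b<a) | ℕ.m≤n⇒m⊔n≡n (ℕ.<⇒≤ b<c) =
  cancel (sgn< a c)
  where
  cancel : ∀ s → 1ℤ ℤ.+ -[1+ 1 ] ℤ.* s ℤ.+ + 2 ℤ.* s ℤ.+ -1ℤ ℤ.* -1ℤ ≡ + 2
  cancel = solve-∀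

data Turn (a b c : ℕ) : Set where
  rising  : a < b → b < c → Turn a b c
  falling : b < a → c < b → Turn a b c
  bent    : bend a b c ≡ + 2 → Turn a b c

turn : ∀ {a b c} → a ≢ b → b ≢ c → Turn a b c
turn {a} {b} {c} a≢b b≢c with ℕ.<-cmp a b | ℕ.<-cmp b c
... | tri< a<b _ _ | tri< b<c _ _ = rising a<b b<c
... | tri< a<b _ _ | tri> _ _ c<b = bent (bend-up-down a<b c<b)
... | tri> _ _ b<a | tri< b<c _ _ = bent (bend-down-up b<a b<c)
... | tri> _ _ b<a | tri> _ _ c<b = falling b<a c<b
... | tri≈ _ a≡b _ | _            = contradiction a≡b a≢b
... | _            | tri≈ _ b≡c _ = contradiction b≡c b≢c

bend-nonneg : ∀ {a b c} → Turn a b c → 0ℤ ℤ.≤ bend a b c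
bend-nonneg (rising a<b b<c)  = ℤ.≤-reflexive (sym (bend-up-up a<b b<c))
bend-nonneg (falling b<a c<b) = ℤ.≤-reflexive (sym (bend-down-down b<a c<b))
bend-nonneg (bent eq)         = subst (0ℤ ℤ.≤_) (sym eq) (ℤ.+≤+ z≤n)

ripple-nonneg : ∀ {D} → Linked _≢_ D → 0ℤ ℤ.≤ earned ripple D
ripple-nonneg {[]}             _  = ℤ.≤-refl
ripple-nonneg {_ ∷ []}         _  = ℤ.≤-refl
ripple-nonneg {_ ∷ _ ∷ []}     _  = ℤ.≤-refl
ripple-nonneg {a ∷ b ∷ c ∷ ds} (a≢b ∷ b≢c ∷ ne) =
  subst (0ℤ ℤ.≤_) (sym (ripple-earned a b c ds))
    (ℤ.+-mono-≤ (bend-nonneg (turn a≢b b≢c)) (ripple-nonneg (b≢c ∷ ne)))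

-- If no triple bends, each continues the direction of the next and the whole list goes one way. A
-- single bend earns 2, and the other triples lose nothing.
ripple-gain : ∀ {D} → Linked _≢_ D → Increasing D ⊎ Decreasing D ⊎ + 2 ℤ.≤ earned ripple D
ripple-gain {[]}         _  = inj₁ []
ripple-gain {_ ∷ []}     _  = inj₁ [-]
ripple-gain {a ∷ b ∷ []} (a≢b ∷ _) with ℕ.<-cmp a b
... | tri< a<b _ _ = inj₁ (a<b ∷ [-])
... | tri≈ _ a≡b _ = contradiction a≡b a≢b
... | tri> _ _ b<a = inj₂ (inj₁ (b<a ∷ [-]))
ripple-gain {a ∷ b ∷ c ∷ ds} (a≢b ∷ b≢c ∷ ne)
  with turn a≢b b≢c | ripple-gain (b≢c ∷ ne)
... | bent eq | _ = inj₂ (inj₂ (subst (+ 2 ℤ.≤_) (sym (ripple-earned a b c ds))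
                      (ℤ.+-mono-≤ (ℤ.≤-reflexive (sym eq)) (ripple-nonneg (b≢c ∷ ne)))))
... | t | inj₂ (inj₂ gain) = inj₂ (inj₂ (subst (+ 2 ℤ.≤_) (sym (ripple-earned a b c ds))
                      (ℤ.+-mono-≤ (bend-nonneg t) gain)))
... | rising a<b b<c  | inj₁ inc               = inj₁ (a<b ∷ inc)
... | rising a<b b<c  | inj₂ (inj₁ (c<b ∷ _))  = contradiction c<b (ℕ.<-asym b<c)
... | falling b<a c<b | inj₁ (b<c ∷ _)         = contradiction b<c (ℕ.<-asym c<b)
... | falling b<a c<b | inj₂ (inj₁ dec)        = inj₂ (inj₁ (b<a ∷ dec))

-- Strategies

-- k is the number of visible faces, L bounds the numbers and B the excesses.
record Strategy (k L B : ℕ) : Set where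
  field
    play     : List ℕ → ℕ → ℤ
    bounded  : ∀ T i → ℤ.∣ play T i ∣ ≤ B
    balanced : ∀ T → length T ≡ k → Σ< (suc k) (play T) ≡ 0ℤ
    gainful  : ∀ S → length S ≡ suc k → Increasing S → All (_< L) S →
               1ℤ ℤ.≤ Σ< (suc k) (λ i → play (remove i S) i)

-- On {x < y} this earns `y` when `x` is hidden and loses `x` when `y` is hidden, in total y - x ≥
-- 1. Truncating at `K` makes the bound hold for every list and changes nothing below `K`.
threshold : ∀ K → Strategy 1 K K
threshold K = record
  { play     = play
  ; bounded  = bounded
  ; balanced = λ { (x ∷ []) _ → cancel (+ (x ⊓ K)) }
  ; gainful  = gainful
  }
  where
  cancel : ∀ z → z ℤ.+ (ℤ.- z ℤ.+ 0ℤ) ≡ 0ℤ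
  cancel = solve-∀
  play : List ℕ → ℕ → ℤ
  play (x ∷ _) 0 = + (x ⊓ K)
  play (x ∷ _) 1 = ℤ.- + (x ⊓ K)
  play _       _ = 0ℤ
  bounded : ∀ T i → ℤ.∣ play T i ∣ ≤ K
  bounded []      i             = z≤n
  bounded (x ∷ _) 0             = ℕ.m⊓n≤n x K
  bounded (x ∷ _) 1             = subst (_≤ K) (sym (ℤ.∣-i∣≡∣i∣ (+ (x ⊓ K)))) (ℕ.m⊓n≤n x K)
  bounded (x ∷ _) (suc (suc i)) = z≤n
  gainful : ∀ S → length S ≡ 2 → Increasing S → All (_< K) S →
            1ℤ ℤ.≤ Σ< 2 (λ i → play (remove i S) i)
  gainful (x ∷ y ∷ []) _ (x<y ∷ _) (x<K ∷ y<K ∷ [])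
    rewrite ℕ.m≤n⇒m⊓n≡m (ℕ.<⇒≤ x<K) | ℕ.m≤n⇒m⊓n≡m (ℕ.<⇒≤ y<K) | ℤ.+-identityʳ (ℤ.- + x) =
    ℤ.0≤i-j⇒j≤i (subst (0ℤ ℤ.≤_) (regroup (+ y) (+ x)) (ℤ.i≤j⇒0≤j-i (ℤ.+≤+ x<y)))
    where
    regroup : ∀ u v → u ℤ.- (1ℤ ℤ.+ v) ≡ u ℤ.+ ℤ.- v ℤ.- 1ℤ
    regroup = solve-∀

-- Stepping up: from sets of gap levels to sets of points

remove-map : ∀ {A B : Set} (f : A → B) i xs → map f (remove i xs) ≡ remove i (map f xs)
remove-map f i       []       = refl
remove-map f zero    (x ∷ xs) = refl
remove-map f (suc i) (x ∷ xs) = cong (f x ∷_) (remove-map f i xs)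

remove-Linked : ∀ {R : ℕ → ℕ → Set} → (∀ {x y z} → R x y → R y z → R x z) →
                ∀ i {xs} → Linked R xs → Linked R (remove i xs)
remove-Linked tr i             []                = []
remove-Linked tr zero          [-]               = []
remove-Linked tr (suc i)       [-]               = [-]
remove-Linked tr zero          (_ ∷ xs)          = xs
remove-Linked tr (suc zero)    (r ∷ [-])         = [-]
remove-Linked tr (suc zero)    (r ∷ (s ∷ xs))    = tr r s ∷ xs
remove-Linked tr (suc (suc i)) (r ∷ xs)          = r ∷ remove-Linked tr (suc i) xs

-- Of two merged gaps the right one is larger and survives, so merging at point `i + 1` deletes gap
-- `i`.
contract-inc : ∀ i {D} → Increasing D → contract (suc i) D ≡ remove i D
contract-inc i       []              = refl
contract-inc zero    [-]             = refl
contract-inc (suc i) ([-] {x})       = refl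
contract-inc zero    (_∷_ {xs = ds} a<b _) = cong (_∷ ds) (ℕ.m≤n⇒m⊔n≡n (ℕ.<⇒≤ a<b))
contract-inc (suc i) (_∷_ {x = a} _ inc) = cong (a ∷_) (contract-inc i inc)

-- Here the left gap survives, so merging at point `i` deletes gap `i`. The last point is excluded:
-- contracting there drops the last gap, while `remove` at that index is out of range.
contract-dec : ∀ i {D} → Decreasing D → (i <ᵇ length D) ≡ true → contract i D ≡ remove i D
contract-dec i             []        i< = refl
contract-dec zero          [-]       i< = refl
contract-dec zero          (_ ∷ _)   i< = refl
contract-dec (suc zero)    (_∷_ {xs = ds} b<a _)  i< = cong (_∷ ds) (ℕ.m≥n⇒m⊔n≡m (ℕ.<⇒≤ b<a))
contract-dec (suc (suc i)) (_∷_ {x = a} _ dec) i< = cong (a ∷_) (contract-dec (suc i) dec i<)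

-- Three gaps leave at least two after a contraction, and the first two still ascend. Hence the rule
-- for decreasing levels stays silent on increasing ones.
contract-inc-¬dec : ∀ i {a b c ds} → Increasing (a ∷ b ∷ c ∷ ds) →
                    ¬ Decreasing (contract i (a ∷ b ∷ c ∷ ds))
contract-inc-¬dec 0 (_ ∷ b<c ∷ _)             (c<b ∷ _) = ℕ.<-asym b<c c<b
contract-inc-¬dec 1 (a<b ∷ b<c ∷ _)           (c<m ∷ _) =
  ℕ.<-asym (ℕ.⊔-pres-<m (ℕ.<-trans a<b b<c) b<c) c<m
contract-inc-¬dec 2 {b = b} {c} (a<b ∷ _)     (m<a ∷ _) = ℕ.<-asym (ℕ.<-≤-trans a<b (ℕ.m≤m⊔n b c)) m<a
contract-inc-¬dec (suc (suc (suc i))) (a<b ∷ _) (b<a ∷ _) = ℕ.<-asym a<b b<a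

contract-dec-¬inc : ∀ i {a b c ds} → Decreasing (a ∷ b ∷ c ∷ ds) →
                    ¬ Increasing (contract i (a ∷ b ∷ c ∷ ds))
contract-dec-¬inc 0 (_ ∷ c<b ∷ _)             (b<c ∷ _) = ℕ.<-asym b<c c<b
contract-dec-¬inc 1 {a} {b} (_ ∷ c<b ∷ _)     (m<c ∷ _) = ℕ.<-asym (ℕ.<-≤-trans c<b (ℕ.m≤n⊔m a b)) m<c
contract-dec-¬inc 2 (b<a ∷ c<b ∷ _)           (a<m ∷ _) =
  ℕ.<-asym (ℕ.⊔-pres-<m b<a (ℕ.<-trans c<b b<a)) a<m
contract-dec-¬inc (suc (suc (suc i))) (b<a ∷ _) (a<b ∷ _) = ℕ.<-asym a<b b<a

module SteppingUp {m L B : ℕ} (s : Strategy (suc m) L B) where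
  open Strategy s renaming (play to base)

  mirror : ℕ → ℕ
  mirror d = L ∸ suc d

  -- There is one more rank than in the base game. By `contract-inc` gap `i` belongs to point
  -- `i + 1`, so the lowest point gets excess 0; by `contract-dec` gap `i` belongs to point `i`, so
  -- the highest point gets excess 0. Reflecting the levels by `mirror` turns a decreasing list into
  -- an increasing one.
  onIncreasing onDecreasing : List ℕ → ℕ → ℤ
  onIncreasing D   = shift (λ i → when (does (increasing? D)) (base D i))
  onDecreasing D i = when (i <ᵇ 2 + m) (when (does (decreasing? D)) (base (map mirror D) i))

  onIncreasing-bound : ∀ D i → ℤ.∣ onIncreasing D i ∣ ≤ B
  onIncreasing-bound D zero    = z≤n
  onIncreasing-bound D (suc i) = when-bound (does (increasing? D)) (bounded D i)

  onDecreasing-bound : ∀ D i → ℤ.∣ onDecreasing D i ∣ ≤ B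
  onDecreasing-bound D i =
    when-bound (i <ᵇ 2 + m) (when-bound (does (decreasing? D)) (bounded (map mirror D) i))

  onIncreasing-balanced : ∀ D → length D ≡ suc m → Σ< (3 + m) (onIncreasing D) ≡ 0ℤ
  onIncreasing-balanced D len = trans (ℤ.+-identityˡ _) (begin
    Σ< (2 + m) (λ i → when b (base D i)) ≡⟨ Σ<-when b (2 + m) (base D) ⟩
    when b (Σ< (2 + m) (base D))         ≡⟨ cong (when b) (balanced D len) ⟩
    when b 0ℤ                            ≡⟨ when-zero b ⟩
    0ℤ                                   ∎)
    where
    open ≡-Reasoning
    b = does (increasing? D)

  onDecreasing-balanced : ∀ D → length D ≡ suc m → Σ< (3 + m) (onDecreasing D) ≡ 0ℤ
  onDecreasing-balanced D len = begin
    Σ< (3 + m) (onDecreasing D)                       ≡⟨ Σ<-truncate (2 + m) (λ i → when b (base D′ i)) ⟩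
    Σ< (2 + m) (λ i → when b (base D′ i))             ≡⟨ Σ<-when b (2 + m) (base D′) ⟩
    when b (Σ< (2 + m) (base D′))
      ≡⟨ cong (when b) (balanced D′ (trans (length-map mirror D) len)) ⟩
    when b 0ℤ                                         ≡⟨ when-zero b ⟩
    0ℤ                                                ∎
    where
    open ≡-Reasoning
    b  = does (decreasing? D)
    D′ = map mirror D

  mirror-Increasing : ∀ {D} → Decreasing D → All (_< L) D → Increasing (map mirror D)
  mirror-Increasing []          _             = []
  mirror-Increasing [-]         _             = [-]
  mirror-Increasing (b<a ∷ dec) (a<L ∷ bd)    = ℕ.∸-monoʳ-< (s<s b<a) a<L ∷ mirror-Increasing dec bd

  mirror-< : ∀ {D} → All (_< L) D → All (_< L) (map mirror D)
  mirror-< []         = []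
  mirror-< (a<L ∷ bd) = ℕ.∸-monoʳ-< z<s a<L ∷ mirror-< bd

  -- Every contraction of an increasing list is increasing, so apart from the zero term at index 0
  -- the sum is exactly what the base rule earns on `D` regarded as a set of numbers.
  onIncreasing-inc : ∀ {D} → Increasing D → All (_< L) D → length D ≡ 2 + m → 1ℤ ℤ.≤ earned onIncreasing D
  onIncreasing-inc {D} inc bd len rewrite len =
    subst (1ℤ ℤ.≤_) (sym (trans (ℤ.+-identityˡ _) (Σ<-cong (2 + m) same))) (gainful D len inc bd)
    where
    same : ∀ i → onIncreasing (contract (suc i) D) (suc i) ≡ base (remove i D) i
    same i rewrite contract-inc i inc
      | dec-true (increasing? (remove i D)) (remove-Linked ℕ.<-trans i inc) = refl

  onDecreasing-dec : ∀ {D} → Decreasing D → All (_< L) D → length D ≡ 2 + m → 1ℤ ℤ.≤ earned onDecreasing D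
  onDecreasing-dec {D} dec bd len = subst (1ℤ ℤ.≤_) (sym earns)
    (gainful (map mirror D) (trans (length-map mirror D) len) (mirror-Increasing dec bd) (mirror-< bd))
    where
    open ≡-Reasoning
    same : ∀ i → (i <ᵇ 2 + m) ≡ true →
           when (does (decreasing? (contract i D))) (base (map mirror (contract i D)) i)
           ≡ base (remove i (map mirror D)) i
    same i i< rewrite contract-dec i dec (trans (cong (i <ᵇ_) len) i<)
      | dec-true (decreasing? (remove i D)) (remove-Linked (λ x y → ℕ.<-trans y x) i dec)
      | remove-map mirror i D = refl
    earns : earned onDecreasing D ≡ Σ< (2 + m) (λ i → base (remove i (map mirror D)) i)
    earns = begin
      earned onDecreasing D
        ≡⟨ cong (λ n → Σ< (suc n) (λ i → onDecreasing (contract i D) i)) len ⟩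
      Σ< (3 + m) (λ i → onDecreasing (contract i D) i)
        ≡⟨ Σ<-cong (3 + m) (λ i → when-cong (i <ᵇ 2 + m) (same i)) ⟩
      Σ< (3 + m) (λ i → when (i <ᵇ 2 + m) (base (remove i (map mirror D)) i))
        ≡⟨ Σ<-truncate (2 + m) (λ i → base (remove i (map mirror D)) i) ⟩
      Σ< (2 + m) (λ i → base (remove i (map mirror D)) i) ∎

  -- A single level counts both as increasing and as decreasing; in that case the
  -- wrong rule earns exactly the balance of the base, which is zero.
  onIncreasing-dec : ∀ {D} → Decreasing D → length D ≡ 2 + m → earned onIncreasing D ≡ 0ℤ
  onIncreasing-dec {a ∷ b ∷ []} (b<a ∷ [-]) refl
    rewrite ℕ.m≥n⇒m⊔n≡m (ℕ.<⇒≤ b<a) = trans (ℤ.+-identityˡ _) (balanced (a ∷ []) refl)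
  onIncreasing-dec {D@(_ ∷ _ ∷ _ ∷ ds)} dec len = Σ<-zero (4 + length ds) none
    where
    none : ∀ i → onIncreasing (contract i D) i ≡ 0ℤ
    none zero    = refl
    none (suc i) rewrite dec-false (increasing? (contract (suc i) D)) (contract-dec-¬inc (suc i) dec) = refl

  onDecreasing-inc : ∀ {D} → Increasing D → length D ≡ 2 + m → earned onDecreasing D ≡ 0ℤ
  onDecreasing-inc {a ∷ b ∷ []} (a<b ∷ [-]) refl
    rewrite ℕ.m≤n⇒m⊔n≡n (ℕ.<⇒≤ a<b) = balanced (mirror b ∷ []) refl
  onDecreasing-inc {D@(_ ∷ _ ∷ _ ∷ ds)} inc len = Σ<-zero (4 + length ds) none
    where
    none : ∀ i → onDecreasing (contract i D) i ≡ 0ℤ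
    none i rewrite dec-false (decreasing? (contract i D)) (contract-inc-¬dec i inc) = when-zero (i <ᵇ 2 + m)

  monotone : List ℕ → ℕ → ℤ
  monotone D i = onIncreasing D i ℤ.+ onDecreasing D i

  -- Large enough for a bend to outweigh all losses of the monotone part.
  R : ℕ
  R = suc ((3 + m) * B)

  rule : List ℕ → ℕ → ℤ
  rule D i = monotone D i ℤ.+ + R ℤ.* ripple D i

  monotone-bound : ∀ D i → ℤ.∣ monotone D i ∣ ≤ B + B
  monotone-bound D i =
    ℕ.≤-trans (ℤ.∣i+j∣≤∣i∣+∣j∣ (onIncreasing D i) (onDecreasing D i))
              (ℕ.+-mono-≤ (onIncreasing-bound D i) (onDecreasing-bound D i))

  rule-bound : ∀ D i → ℤ.∣ rule D i ∣ ≤ B + B + R * 6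
  rule-bound D i = begin
    ℤ.∣ monotone D i ℤ.+ + R ℤ.* ripple D i ∣           ≤⟨ ℤ.∣i+j∣≤∣i∣+∣j∣ (monotone D i) _ ⟩
    ℤ.∣ monotone D i ∣ + ℤ.∣ + R ℤ.* ripple D i ∣       ≡⟨ cong (λ z → ℤ.∣ monotone D i ∣ + z) (ℤ.∣i*j∣≡∣i∣*∣j∣ (+ R) (ripple D i)) ⟩
    ℤ.∣ monotone D i ∣ + R * ℤ.∣ ripple D i ∣           ≤⟨ ℕ.+-mono-≤ (monotone-bound D i) (ℕ.*-monoʳ-≤ R (ripple-bound D i)) ⟩
    B + B + R * 6                                       ∎
    where open ℕ.≤-Reasoning

  rule-sum : ∀ n (F : ℕ → List ℕ) → Σ< n (λ i → rule (F i) i) ≡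
    Σ< n (λ i → onIncreasing (F i) i) ℤ.+ Σ< n (λ i → onDecreasing (F i) i) ℤ.+ + R ℤ.* Σ< n (λ i → ripple (F i) i)
  rule-sum n F =
    trans (Σ<-+ n (λ i → monotone (F i) i) (λ i → + R ℤ.* ripple (F i) i))
      (cong₂ ℤ._+_ (Σ<-+ n (λ i → onIncreasing (F i) i) (λ i → onDecreasing (F i) i))
                   (Σ<-* n (+ R) (λ i → ripple (F i) i)))

  rule-balanced : ∀ D → length D ≡ suc m → Σ< (3 + m) (rule D) ≡ 0ℤ
  rule-balanced D len = begin
    Σ< (3 + m) (rule D) ≡⟨ rule-sum (3 + m) (λ _ → D) ⟩
    Σ< (3 + m) (onIncreasing D) ℤ.+ Σ< (3 + m) (onDecreasing D) ℤ.+ + R ℤ.* Σ< (3 + m) (ripple D)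
      ≡⟨ cong₂ (λ x y → x ℤ.+ + R ℤ.* y)
           (cong₂ ℤ._+_ (onIncreasing-balanced D len) (onDecreasing-balanced D len))
           (trans (cong (λ n → Σ< (2 + n) (ripple D)) (sym len)) (ripple-balanced D)) ⟩
    0ℤ ℤ.+ + R ℤ.* 0ℤ   ≡⟨ cong (λ z → 0ℤ ℤ.+ z) (ℤ.*-zeroʳ (+ R)) ⟩
    0ℤ                  ∎
    where open ≡-Reasoning

  rule-gain : ∀ D → length D ≡ 2 + m → Linked _≢_ D → All (_< L) D → 1ℤ ℤ.≤ earned rule D
  rule-gain D len ne bd =
    subst (1ℤ ℤ.≤_) (sym (rule-sum (suc (length D)) (λ i → contract i D))) (by-shape (ripple-gain ne))
    where
    ripples : 0ℤ ℤ.≤ + R ℤ.* earned ripple D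
    ripples = subst (λ z → z ℤ.≤ + R ℤ.* earned ripple D) (ℤ.*-zeroʳ (+ R)) (ℤ.*-monoˡ-≤-nonNeg (+ R) (ripple-nonneg ne))
    by-shape : Increasing D ⊎ Decreasing D ⊎ + 2 ℤ.≤ earned ripple D →
      1ℤ ℤ.≤ earned onIncreasing D ℤ.+ earned onDecreasing D ℤ.+ + R ℤ.* earned ripple D
    by-shape (inj₁ inc) = ℤ.+-mono-≤
      (ℤ.+-mono-≤ (onIncreasing-inc inc bd len) (ℤ.≤-reflexive (sym (onDecreasing-inc inc len)))) ripples
    by-shape (inj₂ (inj₁ dec)) = ℤ.+-mono-≤
      (ℤ.+-mono-≤ (ℤ.≤-reflexive (sym (onIncreasing-dec dec len))) (onDecreasing-dec dec bd len)) ripples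
    by-shape (inj₂ (inj₂ gain)) = begin
      1ℤ                                      ≤⟨ ℤ.+≤+ (s≤s z≤n) ⟩
      -- On a bent list each monotone part loses at most `M`, while the bend pays `R` = 1 + M twice,
      -- so 2 is left.
      + 2                                     ≡⟨ budget (+ ((3 + m) * B)) ⟩
      ℤ.- + M ℤ.+ ℤ.- + M ℤ.+ (1ℤ ℤ.+ + M) ℤ.* + 2
        ≤⟨ ℤ.+-mono-≤ (ℤ.+-mono-≤ (below onIncreasing onIncreasing-bound) (below onDecreasing onDecreasing-bound))
                      (ℤ.*-monoˡ-≤-nonNeg (+ R) gain) ⟩
      earned onIncreasing D ℤ.+ earned onDecreasing D ℤ.+ + R ℤ.* earned ripple D ∎
      where
      open ℤ.≤-Reasoning
      M = (3 + m) * B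
      budget : ∀ x → + 2 ≡ ℤ.- x ℤ.+ ℤ.- x ℤ.+ (1ℤ ℤ.+ x) ℤ.* + 2
      budget = solve-∀
      below : ∀ f → (∀ D i → ℤ.∣ f D i ∣ ≤ B) → ℤ.- + M ℤ.≤ earned f D
      below f le = neg-bound (earned f D)
        (subst (λ n → ℤ.∣ earned f D ∣ ≤ suc n * B) len (Σ<-bound (suc (length D)) {λ i → f (contract i D) i} (λ i → le (contract i D) i)))
        where
        neg-bound : ∀ z → ℤ.∣ z ∣ ≤ M → ℤ.- + M ℤ.≤ z
        neg-bound (+ n)    le = ℤ.≤-trans (ℤ.neg-≤-pos {M} {0}) (ℤ.+≤+ z≤n)
        neg-bound -[1+ n ] le = ℤ.neg-mono-≤ (ℤ.+≤+ le)

  -- The 2 + m visible numbers have 1 + m gaps, each with a level below `L`: exactly a position of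
  -- the base game.
  step : Strategy (2 + m) (2 ^ L) (B + B + R * 6)
  step = record
    { play     = λ T → rule (gaps L T)
    ; bounded  = λ T → rule-bound (gaps L T)
    ; balanced = λ { (x ∷ T) len → rule-balanced (gaps L (x ∷ T)) (trans (length-gaps L x T) (ℕ.suc-injective len)) }
    ; gainful  = λ { S@(x ∷ S′) len inc bd →
        let len′ = trans (length-gaps L x S′) (ℕ.suc-injective len) in
        subst (1ℤ ℤ.≤_)
          (trans (cong (λ n → Σ< (suc n) (λ i → rule (contract i (gaps L S)) i)) len′)
                 (Σ<-cong (3 + m) (λ i → cong (λ D → rule D i) (sym (gaps-remove L i S inc bd)))))
          (rule-gain (gaps L S) len′ (gaps-distinct L S inc bd) (gaps-< L S inc bd)) }
    }


-- Iterated stepping up and its cost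

weaken : ∀ {k L B B′} → B ≤ B′ → Strategy k L B → Strategy k L B′
weaken B≤B′ s = record
  { play     = play
  ; bounded  = λ T i → ℕ.≤-trans (bounded T i) B≤B′
  ; balanced = balanced
  ; gainful  = gainful
  }
  where open Strategy s

tower2 : ℕ → ℕ → ℕ
tower2 zero    K = K
tower2 (suc m) K = 2 ^ tower2 m K

-- Since 1 ≤ B, the left side is at most B(8 + 6n), and 6n ≥ 8 gives 8 + 6n ≤ (6n)².
step-cost : ∀ n k B → k ≤ n → 2 ≤ n → 1 ≤ B → B + B + suc (k * B) * 6 ≤ B * (6 * n * (6 * n))
step-cost n k B k≤n 2≤n 1≤B = begin
  B + B + suc (k * B) * 6    ≤⟨ ℕ.+-monoʳ-≤ (B + B) (ℕ.*-monoˡ-≤ 6 (ℕ.+-mono-≤ 1≤B (ℕ.*-monoˡ-≤ B k≤n))) ⟩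
  B + B + (B + n * B) * 6    ≡⟨ collect B n ⟩
  B * (8 + 6 * n)            ≤⟨ ℕ.*-monoʳ-≤ B (square (6 * n) (ℕ.≤-trans (ℕ.m≤m+n 8 4) (ℕ.*-monoʳ-≤ 6 2≤n))) ⟩
  B * (6 * n * (6 * n))      ∎
  where
  open ℕ.≤-Reasoning
  collect : ∀ B n → B + B + (B + n * B) * 6 ≡ B * (8 + 6 * n)
  collect = ℕ-solve-∀
  square : ∀ P → 8 ≤ P → 8 + P ≤ P * P
  square P 8≤P = begin
    8 + P    ≤⟨ ℕ.+-monoˡ-≤ P 8≤P ⟩
    P + P    ≡⟨ cong (λ z → P + z) (ℕ.+-identityʳ P) ⟨
    2 * P    ≤⟨ ℕ.*-monoˡ-≤ P (ℕ.≤-trans (ℕ.m≤m+n 2 6) 8≤P) ⟩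
    P * P    ∎

-- The final number of faces `n` stays fixed during the induction, so each of the `m` steps costs
-- the same factor (6n)².
strategy : ∀ n K → 1 ≤ K → ∀ m → 2 + m ≤ n →
           Strategy (suc m) (tower2 m K) (K * (6 * n * (6 * n)) ^ m)
strategy n K 1≤K zero    m<n = weaken (ℕ.≤-reflexive (sym (ℕ.*-identityʳ K))) (threshold K)
strategy n K 1≤K (suc m) m<n =
  weaken (ℕ.≤-trans (step-cost n (3 + m) B m<n (ℕ.m+n≤o⇒m≤o 2 (ℕ.<⇒≤ m<n)) 1≤B) (ℕ.≤-reflexive regroup))
    (SteppingUp.step (strategy n K 1≤K m (ℕ.<⇒≤ m<n)))
  where
  C = 6 * n * (6 * n)
  B = K * C ^ m
  instance
    n≢0 : ℕ.NonZero n
    n≢0 = ℕ.>-nonZero (ℕ.<-≤-trans z<s m<n)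
    6n≢0 : ℕ.NonZero (6 * n)
    6n≢0 = ℕ.m*n≢0 6 n
    C≢0 : ℕ.NonZero C
    C≢0 = ℕ.m*n≢0 (6 * n) (6 * n)
  1≤B : 1 ≤ B
  1≤B = ℕ.*-mono-≤ 1≤K (ℕ.m^n>0 C m)
  regroup : B * C ≡ K * C ^ suc m
  regroup = trans (ℕ.*-assoc K (C ^ m) C) (cong (K *_) (ℕ.*-comm (C ^ m) C))

-- Finite sums of rationals

Σℚ : {A : Set} → List A → (A → ℚ) → ℚ
Σℚ xs f = foldr ℚ._+_ 0ℚ (map f xs)

whenℚ : Bool → ℚ → ℚ
whenℚ b q = if b then q else 0ℚ

whenℚ-cong : ∀ b {x y} → (T b → x ≡ y) → whenℚ b x ≡ whenℚ b y
whenℚ-cong true  eq = eq _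
whenℚ-cong false eq = refl

whenℚ-∧ : ∀ a b {x} → whenℚ (a ∧ b) x ≡ whenℚ a (whenℚ b x)
whenℚ-∧ true  b = refl
whenℚ-∧ false b = refl

+-interchange : ∀ a b c d → (a ℚ.+ b) ℚ.+ (c ℚ.+ d) ≡ (a ℚ.+ c) ℚ.+ (b ℚ.+ d)
+-interchange = solve 4 (λ a b c d → (a :+ b) :+ (c :+ d) := (a :+ c) :+ (b :+ d)) refl
  where open +-*-Solver

module _ {A : Set} where

  Σℚ-cong : ∀ (xs : List A) {f g} → (∀ x → f x ≡ g x) → Σℚ xs f ≡ Σℚ xs g
  Σℚ-cong []       eq = refl
  Σℚ-cong (x ∷ xs) eq = cong₂ ℚ._+_ (eq x) (Σℚ-cong xs eq)

  Σℚ-zero : ∀ (xs : List A) → Σℚ xs (λ _ → 0ℚ) ≡ 0ℚ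
  Σℚ-zero []       = refl
  Σℚ-zero (x ∷ xs) = trans (ℚ.+-identityˡ _) (Σℚ-zero xs)

  Σℚ-+ : ∀ (xs : List A) f g → Σℚ xs (λ x → f x ℚ.+ g x) ≡ Σℚ xs f ℚ.+ Σℚ xs g
  Σℚ-+ []       f g = refl
  Σℚ-+ (x ∷ xs) f g =
    trans (cong (λ z → (f x ℚ.+ g x) ℚ.+ z) (Σℚ-+ xs f g)) (+-interchange (f x) (g x) (Σℚ xs f) (Σℚ xs g))

  Σℚ-* : ∀ (xs : List A) c f → Σℚ xs (λ x → c ℚ.* f x) ≡ c ℚ.* Σℚ xs f
  Σℚ-* []       c f = sym (ℚ.*-zeroʳ c)
  Σℚ-* (x ∷ xs) c f =
    trans (cong (λ z → c ℚ.* f x ℚ.+ z) (Σℚ-* xs c f)) (sym (ℚ.*-distribˡ-+ c (f x) (Σℚ xs f)))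

  Σℚ-whenℚ : ∀ b (xs : List A) f → Σℚ xs (λ x → whenℚ b (f x)) ≡ whenℚ b (Σℚ xs f)
  Σℚ-whenℚ true  xs f = refl
  Σℚ-whenℚ false xs f = Σℚ-zero xs

  Σℚ-filter : ∀ {P : A → Set} (P? : Decidable P) xs f →
              Σℚ (filter P? xs) f ≡ Σℚ xs (λ x → whenℚ (does (P? x)) (f x))
  Σℚ-filter P? []       f = refl
  Σℚ-filter P? (x ∷ xs) f with does (P? x)
  ... | true  = cong (λ z → f x ℚ.+ z) (Σℚ-filter P? xs f)
  ... | false = trans (Σℚ-filter P? xs f) (sym (ℚ.+-identityˡ _))

  Σℚ-++ : ∀ (xs ys : List A) f → Σℚ (xs ++ ys) f ≡ Σℚ xs f ℚ.+ Σℚ ys f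
  Σℚ-++ []       ys f = sym (ℚ.+-identityˡ _)
  Σℚ-++ (x ∷ xs) ys f = trans (cong (λ z → f x ℚ.+ z) (Σℚ-++ xs ys f)) (sym (ℚ.+-assoc (f x) _ _))

Σℚ-map : ∀ {A B : Set} (h : A → B) xs f → Σℚ (map h xs) f ≡ Σℚ xs (f ∘ h)
Σℚ-map h []       f = refl
Σℚ-map h (x ∷ xs) f = cong (λ z → f (h x) ℚ.+ z) (Σℚ-map h xs f)

Σℚ-product : ∀ {A B C : Set} (h : A → B → C) xs ys f →
             Σℚ (cartesianProductWith h xs ys) f ≡ Σℚ xs (λ x → Σℚ ys (λ y → f (h x y)))
Σℚ-product h []       ys f = refl
Σℚ-product h (x ∷ xs) ys f =
  trans (Σℚ-++ (map (h x) ys) _ f) (cong₂ ℚ._+_ (Σℚ-map (h x) ys f) (Σℚ-product h xs ys f))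

Σℚ-swap : ∀ {A B : Set} (xs : List A) (ys : List B) (f : A → B → ℚ) →
          Σℚ xs (λ x → Σℚ ys (f x)) ≡ Σℚ ys (λ y → Σℚ xs (λ x → f x y))
Σℚ-swap []       ys f = sym (Σℚ-zero ys)
Σℚ-swap (x ∷ xs) ys f =
  trans (cong (λ z → Σℚ ys (f x) ℚ.+ z) (Σℚ-swap xs ys f)) (sym (Σℚ-+ ys (f x) _))

Σℚ-allFin : ∀ n (f : Fin (suc n) → ℚ) → Σℚ (allFin (suc n)) f ≡ f zero ℚ.+ Σℚ (allFin n) (f ∘ suc)
Σℚ-allFin n f = cong (λ xs → f zero ℚ.+ foldr ℚ._+_ 0ℚ xs)
  (trans (map-tabulate suc f) (sym (map-tabulate (λ i → i) (f ∘ suc))))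

-- Integers as rationals

ι : ℤ → ℚ
ι z = z ℚ./ 1

toℚᵘ-ι : ∀ z → ℚ.toℚᵘ (ι z) ℚᵘ.≃ mkℚᵘ z 0
toℚᵘ-ι z = ℚ.toℚᵘ-fromℚᵘ (mkℚᵘ z 0)

ι-+ : ∀ a b → ι (a ℤ.+ b) ≡ ι a ℚ.+ ι b
ι-+ a b = ℚ.toℚᵘ-injective (begin
  ℚ.toℚᵘ (ι (a ℤ.+ b))                   ≈⟨ toℚᵘ-ι (a ℤ.+ b) ⟩
  mkℚᵘ (a ℤ.+ b) 0                       ≈⟨ *≡* (eq a b) ⟩
  mkℚᵘ a 0 ℚᵘ.+ mkℚᵘ b 0                 ≈⟨ ℚᵘ.+-cong (toℚᵘ-ι a) (toℚᵘ-ι b) ⟨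
  ℚ.toℚᵘ (ι a) ℚᵘ.+ ℚ.toℚᵘ (ι b)         ≈⟨ ℚ.toℚᵘ-homo-+ (ι a) (ι b) ⟨
  ℚ.toℚᵘ (ι a ℚ.+ ι b)                   ∎)
  where
  open ℚᵘ.≃-Reasoning
  eq : ∀ a b → (a ℤ.+ b) ℤ.* 1ℤ ≡ (a ℤ.* 1ℤ ℤ.+ b ℤ.* 1ℤ) ℤ.* 1ℤ
  eq = solve-∀

ι-* : ∀ a b → ι (a ℤ.* b) ≡ ι a ℚ.* ι b
ι-* a b = ℚ.toℚᵘ-injective (begin
  ℚ.toℚᵘ (ι (a ℤ.* b))                   ≈⟨ toℚᵘ-ι (a ℤ.* b) ⟩
  mkℚᵘ (a ℤ.* b) 0                       ≈⟨ *≡* refl ⟩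
  mkℚᵘ a 0 ℚᵘ.* mkℚᵘ b 0                 ≈⟨ ℚᵘ.*-cong (toℚᵘ-ι a) (toℚᵘ-ι b) ⟨
  ℚ.toℚᵘ (ι a) ℚᵘ.* ℚ.toℚᵘ (ι b)         ≈⟨ ℚ.toℚᵘ-homo-* (ι a) (ι b) ⟨
  ℚ.toℚᵘ (ι a ℚ.* ι b)                   ∎)
  where open ℚᵘ.≃-Reasoning

ι-mono-≤ : ∀ {a b} → a ℤ.≤ b → ι a ℚ.≤ ι b
ι-mono-≤ {a} {b} a≤b = ℚ.toℚᵘ-cancel-≤ (begin
  ℚ.toℚᵘ (ι a)   ≃⟨ toℚᵘ-ι a ⟩
  mkℚᵘ a 0       ≤⟨ *≤* (ℤ.*-monoʳ-≤-nonNeg 1ℤ a≤b) ⟩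
  mkℚᵘ b 0       ≃⟨ toℚᵘ-ι b ⟨
  ℚ.toℚᵘ (ι b)   ∎)
  where open ℚᵘ.≤-Reasoning

0≤ι : ∀ k → 0ℚ ℚ.≤ ι (+ k)
0≤ι k = ι-mono-≤ {0ℤ} {+ k} (ℤ.+≤+ z≤n)

ι-cancel-< : ∀ {a b} → ι a ℚ.< ι b → a ℤ.< b
ι-cancel-< {a} {b} a<b with b ℤ.≤? a
... | yes b≤a = contradiction (ℚ.<-≤-trans a<b (ι-mono-≤ b≤a)) (ℚ.<-irrefl refl)
... | no  b≰a = ℤ.≰⇒> b≰a

ι-inverse : ∀ d .{{_ : ℕ.NonZero d}} → ι (+ d) ℚ.* (1ℤ ℚ./ d) ≡ 1ℚ
ι-inverse (suc d) = ℚ.toℚᵘ-injective (begin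
  ℚ.toℚᵘ (ι (+ suc d) ℚ.* (1ℤ ℚ./ suc d))            ≈⟨ ℚ.toℚᵘ-homo-* (ι (+ suc d)) (1ℤ ℚ./ suc d) ⟩
  ℚ.toℚᵘ (ι (+ suc d)) ℚᵘ.* ℚ.toℚᵘ (1ℤ ℚ./ suc d)
    ≈⟨ ℚᵘ.*-cong (toℚᵘ-ι (+ suc d)) (ℚ.toℚᵘ-fromℚᵘ (mkℚᵘ 1ℤ d)) ⟩
  mkℚᵘ (+ suc d) 0 ℚᵘ.* mkℚᵘ 1ℤ d                    ≈⟨ *≡* (eq (+ suc d)) ⟩
  ℚ.toℚᵘ 1ℚ                                          ∎)
  where
  open ℚᵘ.≃-Reasoning
  eq : ∀ z → z ℤ.* 1ℤ ℤ.* 1ℤ ≡ 1ℤ ℤ.* (1ℤ ℤ.* z)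
  eq = solve-∀

Σℚ-ι : ∀ n f → Σℚ (allFin n) (λ i → ι (f (toℕ i))) ≡ ι (Σ< n f)
Σℚ-ι zero    f = refl
Σℚ-ι (suc n) f = begin
  Σℚ (allFin (suc n)) (λ i → ι (f (toℕ i)))               ≡⟨ Σℚ-allFin n (λ i → ι (f (toℕ i))) ⟩
  ι (f 0) ℚ.+ Σℚ (allFin n) (λ i → ι (f (suc (toℕ i))))   ≡⟨ cong (λ z → ι (f 0) ℚ.+ z) (Σℚ-ι n (f ∘ suc)) ⟩
  ι (f 0) ℚ.+ ι (Σ< n (f ∘ suc))                          ≡⟨ ι-+ (f 0) (Σ< n (f ∘ suc)) ⟨
  ι (Σ< (suc n) f)                                        ∎
  where open ≡-Reasoning

-- Arrangements of a set

-- A recursive form of the condition in `IsRollOf`. Each entry is taken out of the set before the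
-- next one is tested, which enforces distinctness and lets sums over arrangements be computed by
-- induction.
arrangement : ∀ {N k} → Subset N → Vec (Fin N) k → Bool
arrangement S []      = true
arrangement S (x ∷ v) = lookup S x ∧ arrangement (S [ x ]≔ outside) v

elements : ∀ {N} → Subset N → List ℕ
elements []            = []
elements (outside ∷ S) = map suc (elements S)
elements (inside ∷ S)  = 0 ∷ map suc (elements S)

rank : ∀ {N} → Subset N → Fin N → ℕ
rank (_ ∷ S)       zero    = 0
rank (outside ∷ S) (suc x) = rank S x
rank (inside ∷ S)  (suc x) = suc (rank S x)

sorted : ∀ {N k} → Vec (Fin N) k → List ℕ
sorted v = sort (map toℕ (Vec.toList v))

∈-remove : ∀ {N} {S : Subset N} {x y} → y ∈ S [ x ]≔ outside → x ≢ y × y ∈ S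
∈-remove {S = S} {x} {y} y∈ = x≢y , Vec.lookup⇒[]= y S
    (trans (sym (Vec.lookup∘update′ (x≢y ∘ sym) S outside)) (Vec.[]=⇒lookup y∈))
  where
  x≢y : x ≢ y
  x≢y refl with trans (sym (Vec.[]=⇒lookup y∈)) (Vec.lookup∘update x S outside)
  ... | ()

remove-∈ : ∀ {N} {S : Subset N} {x y} → x ≢ y → y ∈ S → y ∈ S [ x ]≔ outside
remove-∈ {S = S} {x} {y} x≢y y∈ = Vec.lookup⇒[]= y (S [ x ]≔ outside)
  (trans (Vec.lookup∘update′ (x≢y ∘ sym) S outside) (Vec.[]=⇒lookup y∈))

T⇒∈ : ∀ {N} (S : Subset N) x → T (lookup S x) → x ∈ S
T⇒∈ S x Sx = Vec.lookup⇒[]= x S (T⇒≡ (lookup S x) Sx)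
  where
  T⇒≡ : ∀ b → T b → b ≡ true
  T⇒≡ true _ = refl

∈⇒T : ∀ {N} {S : Subset N} {x} → x ∈ S → T (lookup S x)
∈⇒T x∈S = subst T (sym (Vec.[]=⇒lookup x∈S)) _

arrangement-sound : ∀ {N k} (S : Subset N) (v : Vec (Fin N) k) → T (arrangement S v) →
                    Unique v × VecAll.All (_∈ S) v
arrangement-sound S []      _ = [] , []
arrangement-sound S (x ∷ v) t =
  let Sx , t′   = Equivalence.to T-∧ t
      uniq , mem = arrangement-sound (S [ x ]≔ outside) v t′
  in (VecAll.map (proj₁ ∘ ∈-remove) mem ∷ uniq) , (T⇒∈ S x Sx ∷ VecAll.map (proj₂ ∘ ∈-remove) mem)

arrangement-complete : ∀ {N k} (S : Subset N) (v : Vec (Fin N) k) → Unique v × VecAll.All (_∈ S) v →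
                       T (arrangement S v)
arrangement-complete S []      _ = _
arrangement-complete S (x ∷ v) ((x∉v ∷ uniq) , (x∈S ∷ mem)) =
  Equivalence.from T-∧ (∈⇒T x∈S , arrangement-complete (S [ x ]≔ outside) v
    (uniq , VecAll.map (λ (x≢y , y∈S) → remove-∈ x≢y y∈S) (VecAll.zip (x∉v , mem))))

-- The hidden number comes first, so that the visible ones become an arrangement of the set without
-- it.
does-isRollOf? : ∀ {n N} (S : Subset N) v h → does (isRollOf? {n} S (v , h)) ≡ arrangement S (h ∷ v)
does-isRollOf? {n} S v h =
  does-⇔ (mk⇔ (arrangement-complete S (h ∷ v)) (arrangement-sound S (h ∷ v)))
         (isRollOf? {n} S (v , h)) (T? (arrangement S (h ∷ v)))

card-remove : ∀ {N} (S : Subset N) x → T (lookup S x) → suc ∣ S [ x ]≔ outside ∣ ≡ ∣ S ∣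
card-remove (inside ∷ S)  zero    _  = refl
card-remove (inside ∷ S)  (suc x) Sx = cong suc (card-remove S x Sx)
card-remove (outside ∷ S) (suc x) Sx = card-remove S x Sx

length-elements : ∀ {N} (S : Subset N) → length (elements S) ≡ ∣ S ∣
length-elements []            = refl
length-elements (inside ∷ S)  = cong suc (trans (length-map suc (elements S)) (length-elements S))
length-elements (outside ∷ S) = trans (length-map suc (elements S)) (length-elements S)

elements-Increasing : ∀ {N} (S : Subset N) → Increasing (elements S)
elements-Increasing S = go S
  where
  map-suc : ∀ {xs} → Increasing xs → Increasing (map suc xs)
  map-suc []          = []
  map-suc [-]         = [-]
  map-suc (x<y ∷ inc) = s<s x<y ∷ map-suc inc
  0∷-map-suc : ∀ {xs} → Increasing xs → Increasing (0 ∷ map suc xs)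
  0∷-map-suc []          = [-]
  0∷-map-suc [-]         = z<s ∷ [-]
  0∷-map-suc (x<y ∷ inc) = z<s ∷ map-suc (x<y ∷ inc)
  go : ∀ {N} (S : Subset N) → Increasing (elements S)
  go []            = []
  go (inside ∷ S)  = 0∷-map-suc (go S)
  go (outside ∷ S) = map-suc (go S)

elements-< : ∀ {N} (S : Subset N) → All (_< N) (elements S)
elements-< []            = []
elements-< (inside ∷ S)  = z<s ∷ map⁺ (All.map s<s (elements-< S))
elements-< (outside ∷ S) = map⁺ (All.map s<s (elements-< S))

insert-suc : ∀ x xs → insert (suc x) (map suc xs) ≡ map suc (insert x xs)
insert-suc x       []       = refl
insert-suc zero    (y ∷ ys) = refl
insert-suc (suc x) (y ∷ ys) with x <ᵇ y
... | true  = refl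
... | false = cong (suc y ∷_) (insert-suc (suc x) ys)

insert-elements : ∀ {N} (S : Subset N) x → T (lookup S x) →
                  insert (toℕ x) (elements (S [ x ]≔ outside)) ≡ elements S
insert-elements (inside ∷ S) zero _ = insert-0 (elements S)
  where
  insert-0 : ∀ xs → insert 0 (map suc xs) ≡ 0 ∷ map suc xs
  insert-0 []       = refl
  insert-0 (x ∷ xs) = refl
insert-elements (inside ∷ S)  (suc x) Sx =
  cong (0 ∷_) (trans (insert-suc (toℕ x) (elements (S [ x ]≔ outside))) (cong (map suc) (insert-elements S x Sx)))
insert-elements (outside ∷ S) (suc x) Sx =
  trans (insert-suc (toℕ x) (elements (S [ x ]≔ outside))) (cong (map suc) (insert-elements S x Sx))

-- Insertion sort puts back the entries that `arrangement` took out, one at a time. Hence the order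
-- of the visible faces does not influence the play.
sorted-arrangement : ∀ {N k} (S : Subset N) (v : Vec (Fin N) k) → T (arrangement S v) → ∣ S ∣ ≡ k →
                     sorted v ≡ elements S
sorted-arrangement S []      _ card = sym (length-0 (elements S) (trans (length-elements S) card))
  where
  length-0 : ∀ (xs : List ℕ) → length xs ≡ 0 → xs ≡ []
  length-0 [] _ = refl
sorted-arrangement S (x ∷ v) t card =
  let Sx , t′ = Equivalence.to T-∧ t in
  trans (cong (insert (toℕ x)) (sorted-arrangement (S [ x ]≔ outside) v t′
                                 (ℕ.suc-injective (trans (card-remove S x Sx) card))))
        (insert-elements S x Sx)

elements-remove : ∀ {N} (S : Subset N) h → T (lookup S h) →
                  elements (S [ h ]≔ outside) ≡ remove (rank S h) (elements S)
elements-remove (inside ∷ S)  zero    _  = refl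
elements-remove (inside ∷ S)  (suc h) Sh =
  cong (0 ∷_) (trans (cong (map suc) (elements-remove S h Sh)) (remove-map suc (rank S h) (elements S)))
elements-remove (outside ∷ S) (suc h) Sh =
  trans (cong (map suc) (elements-remove S h Sh)) (remove-map suc (rank S h) (elements S))

rank-remove-self : ∀ {N} (S : Subset N) h → rank (S [ h ]≔ outside) h ≡ rank S h
rank-remove-self (_ ∷ S)       zero    = refl
rank-remove-self (inside ∷ S)  (suc h) = cong suc (rank-remove-self S h)
rank-remove-self (outside ∷ S) (suc h) = rank-remove-self S h

-- Taking out `x` lowers the rank of `h` by one exactly when `x` lies below `h`. The left side has
-- the shape of one step of `Vec.count`.
rank-remove : ∀ {N} (S : Subset N) x h → T (lookup S x) →
              (if does (x Fin.<? h) then suc else λ r → r) (rank (S [ x ]≔ outside) h) ≡ rank S h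
rank-remove (_ ∷ S)       zero    zero    _  = refl
rank-remove (_ ∷ S)       (suc x) zero    _  = refl
rank-remove (inside ∷ S)  zero    (suc h) _  = refl
rank-remove (outside ∷ S) (suc x) (suc h) Sx = rank-remove S x h Sx
rank-remove (inside ∷ S)  (suc x) (suc h) Sx with does (x Fin.<? h) | rank-remove S x h Sx
... | true  | eq = cong suc eq
... | false | eq = cong suc eq

rank-≤ : ∀ {N} (S : Subset N) h → rank S h ≤ ∣ S ∣
rank-≤ (_ ∷ S)       zero    = z≤n
rank-≤ (inside ∷ S)  (suc h) = s≤s (rank-≤ S h)
rank-≤ (outside ∷ S) (suc h) = rank-≤ S h

count-arrangement : ∀ {N k} (S : Subset N) (v : Vec (Fin N) k) h → T (arrangement S v) → ∣ S ∣ ≡ k →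
                    Vec.count (Fin._<? h) v ≡ rank S h
count-arrangement S []      h _ card = sym (ℕ.n≤0⇒n≡0 (subst (rank S h ≤_) card (rank-≤ S h)))
count-arrangement S (x ∷ v) h t card =
  let Sx , t′ = Equivalence.to T-∧ t in
  trans (cong (if does (x Fin.<? h) then suc else (λ r → r))
          (count-arrangement (S [ x ]≔ outside) v h t′ (ℕ.suc-injective (trans (card-remove S x Sx) card))))
        (rank-remove S x h Sx)

-- Sums over arrangements and rolls

Σℚ-rank : ∀ {N} (S : Subset N) (g : ℕ → ℚ) →
          Σℚ (allFin N) (λ x → whenℚ (lookup S x) (g (rank S x))) ≡ Σℚ (allFin ∣ S ∣) (λ i → g (toℕ i))
Σℚ-rank []      g = refl
Σℚ-rank {suc N} (inside ∷ S) g = begin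
  Σℚ (allFin (suc N)) (λ x → whenℚ (lookup (inside ∷ S) x) (g (rank (inside ∷ S) x)))
    ≡⟨ Σℚ-allFin N (λ x → whenℚ (lookup (inside ∷ S) x) (g (rank (inside ∷ S) x))) ⟩
  g 0 ℚ.+ Σℚ (allFin N) (λ x → whenℚ (lookup S x) (g (suc (rank S x))))
    ≡⟨ cong (λ z → g 0 ℚ.+ z) (Σℚ-rank S (g ∘ suc)) ⟩
  g 0 ℚ.+ Σℚ (allFin ∣ S ∣) (λ i → g (suc (toℕ i)))
    ≡⟨ Σℚ-allFin ∣ S ∣ (λ i → g (toℕ i)) ⟨
  Σℚ (allFin (suc ∣ S ∣)) (λ i → g (toℕ i)) ∎
  where open ≡-Reasoning
Σℚ-rank {suc N} (outside ∷ S) g = begin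
  Σℚ (allFin (suc N)) (λ x → whenℚ (lookup (outside ∷ S) x) (g (rank (outside ∷ S) x)))
    ≡⟨ Σℚ-allFin N (λ x → whenℚ (lookup (outside ∷ S) x) (g (rank (outside ∷ S) x))) ⟩
  0ℚ ℚ.+ Σℚ (allFin N) (λ x → whenℚ (lookup S x) (g (rank S x)))
    ≡⟨ trans (ℚ.+-identityˡ _) (Σℚ-rank S g) ⟩
  Σℚ (allFin ∣ S ∣) (λ i → g (toℕ i)) ∎
  where open ≡-Reasoning

Σℚ-const : ∀ n c → Σℚ (allFin n) (λ _ → c) ≡ ι (+ n) ℚ.* c
Σℚ-const zero    c = sym (ℚ.*-zeroˡ c)
Σℚ-const (suc n) c = begin
  Σℚ (allFin (suc n)) (λ _ → c)      ≡⟨ Σℚ-allFin n (λ _ → c) ⟩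
  c ℚ.+ Σℚ (allFin n) (λ _ → c)      ≡⟨ cong₂ ℚ._+_ (sym (ℚ.*-identityˡ c)) (Σℚ-const n c) ⟩
  1ℚ ℚ.* c ℚ.+ ι (+ n) ℚ.* c         ≡⟨ ℚ.*-distribʳ-+ c 1ℚ (ι (+ n)) ⟨
  (1ℚ ℚ.+ ι (+ n)) ℚ.* c             ≡⟨ cong (ℚ._* c) (ι-+ 1ℤ (+ n)) ⟨
  ι (+ suc n) ℚ.* c                  ∎
  where open ≡-Reasoning

-- Any member of `S` may come first, and by induction the rest can be arranged in `k !` ways.
Σℚ-arrangements : ∀ {N} k (S : Subset N) → ∣ S ∣ ≡ k → ∀ c →
  Σℚ (vectors (allFin N) k) (λ v → whenℚ (arrangement S v) c) ≡ ι (+ (k !)) ℚ.* c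
Σℚ-arrangements zero    S card c = trans (ℚ.+-identityʳ c) (sym (ℚ.*-identityˡ c))
Σℚ-arrangements {N} (suc k) S card c = begin
  Σℚ (vectors (allFin N) (suc k)) (λ v → whenℚ (arrangement S v) c)
    ≡⟨ Σℚ-product _∷_ (allFin N) vs (λ v → whenℚ (arrangement S v) c) ⟩
  Σℚ (allFin N) (λ x → Σℚ vs (λ v → whenℚ (lookup S x ∧ arrangement (S [ x ]≔ outside) v) c))
    ≡⟨ Σℚ-cong (allFin N) each ⟩
  Σℚ (allFin N) (λ x → whenℚ (lookup S x) (ι (+ (k !)) ℚ.* c))
    ≡⟨ Σℚ-rank S (λ _ → ι (+ (k !)) ℚ.* c) ⟩
  Σℚ (allFin ∣ S ∣) (λ _ → ι (+ (k !)) ℚ.* c)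
    ≡⟨ Σℚ-const ∣ S ∣ (ι (+ (k !)) ℚ.* c) ⟩
  ι (+ ∣ S ∣) ℚ.* (ι (+ (k !)) ℚ.* c)
    ≡⟨ ℚ.*-assoc (ι (+ ∣ S ∣)) (ι (+ (k !))) c ⟨
  (ι (+ ∣ S ∣) ℚ.* ι (+ (k !))) ℚ.* c
    ≡⟨ cong (ℚ._* c) (sym (ι-* (+ ∣ S ∣) (+ (k !)))) ⟩
  ι (+ ∣ S ∣ ℤ.* + (k !)) ℚ.* c
    ≡⟨ cong (λ z → ι z ℚ.* c) (trans (cong (λ n → + n ℤ.* + (k !)) card) (sym (ℤ.pos-* (suc k) (k !)))) ⟩
  ι (+ (suc k !)) ℚ.* c ∎
  where
  open ≡-Reasoning
  vs = vectors (allFin N) k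
  each : ∀ x → Σℚ vs (λ v → whenℚ (lookup S x ∧ arrangement (S [ x ]≔ outside) v) c)
             ≡ whenℚ (lookup S x) (ι (+ (k !)) ℚ.* c)
  each x = begin
    Σℚ vs (λ v → whenℚ (lookup S x ∧ arrangement (S [ x ]≔ outside) v) c)
      ≡⟨ Σℚ-cong vs (λ v → whenℚ-∧ (lookup S x) (arrangement (S [ x ]≔ outside) v)) ⟩
    Σℚ vs (λ v → whenℚ (lookup S x) (whenℚ (arrangement (S [ x ]≔ outside) v) c))
      ≡⟨ Σℚ-whenℚ (lookup S x) vs _ ⟩
    whenℚ (lookup S x) (Σℚ vs (λ v → whenℚ (arrangement (S [ x ]≔ outside) v) c))
      ≡⟨ whenℚ-cong (lookup S x) (λ Sx → Σℚ-arrangements k (S [ x ]≔ outside)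
           (ℕ.suc-injective (trans (card-remove S x Sx) card)) c) ⟩
    whenℚ (lookup S x) (ι (+ (k !)) ℚ.* c) ∎

-- Once the hidden number is fixed, all `k !` orders of the visible ones have the same value, since
-- `ω` depends only on the sorted list and the hidden rank. What remains is one term for each rank.
Σℚ-rolls : ∀ {N} k (S : Subset N) → ∣ S ∣ ≡ suc k → (ω : List ℕ → ℕ → ℚ) →
  Σℚ (rolls (suc k) S) (λ ρ → ω (sorted (proj₁ ρ)) (hiddenRank {suc k} ρ))
  ≡ ι (+ (k !)) ℚ.* Σℚ (allFin (suc k)) (λ i → ω (remove (toℕ i) (elements S)) (toℕ i))
Σℚ-rolls {N} k S card ω = begin
  Σℚ (rolls (suc k) S) φ
    ≡⟨ Σℚ-filter (isRollOf? {suc k} S) (cartesianProduct vs (allFin N)) φ ⟩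
  Σℚ (cartesianProduct vs (allFin N)) (λ ρ → whenℚ (does (isRollOf? {suc k} S ρ)) (φ ρ))
    ≡⟨ Σℚ-product _,_ vs (allFin N) (λ ρ → whenℚ (does (isRollOf? {suc k} S ρ)) (φ ρ)) ⟩
  Σℚ vs (λ v → Σℚ (allFin N) (λ h → whenℚ (does (isRollOf? {suc k} S (v , h))) (φ (v , h))))
    -- Choose the hidden number first.
    ≡⟨ Σℚ-swap vs (allFin N) (λ v h → whenℚ (does (isRollOf? {suc k} S (v , h))) (φ (v , h))) ⟩
  Σℚ (allFin N) (λ h → Σℚ vs (λ v → whenℚ (does (isRollOf? {suc k} S (v , h))) (φ (v , h))))
    ≡⟨ Σℚ-cong (allFin N) each ⟩
  Σℚ (allFin N) (λ h → whenℚ (lookup S h) (ι (+ (k !)) ℚ.* G (rank S h)))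
    ≡⟨ Σℚ-rank S (λ r → ι (+ (k !)) ℚ.* G r) ⟩
  Σℚ (allFin ∣ S ∣) (λ i → ι (+ (k !)) ℚ.* G (toℕ i))
    ≡⟨ cong (λ n → Σℚ (allFin n) (λ i → ι (+ (k !)) ℚ.* G (toℕ i))) card ⟩
  Σℚ (allFin (suc k)) (λ i → ι (+ (k !)) ℚ.* G (toℕ i))
    ≡⟨ Σℚ-* (allFin (suc k)) (ι (+ (k !))) (λ i → G (toℕ i)) ⟩
  ι (+ (k !)) ℚ.* Σℚ (allFin (suc k)) (λ i → G (toℕ i)) ∎
  where
  open ≡-Reasoning
  vs = vectors (allFin N) k
  φ : Roll (suc k) N → ℚ
  φ ρ = ω (sorted (proj₁ ρ)) (hiddenRank {suc k} ρ)
  G : ℕ → ℚ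
  G i = ω (remove i (elements S)) i
  each : ∀ h → Σℚ vs (λ v → whenℚ (does (isRollOf? {suc k} S (v , h))) (φ (v , h)))
             ≡ whenℚ (lookup S h) (ι (+ (k !)) ℚ.* G (rank S h))
  each h = begin
    Σℚ vs (λ v → whenℚ (does (isRollOf? {suc k} S (v , h))) (φ (v , h)))
      ≡⟨ Σℚ-cong vs (λ v → cong (λ b → whenℚ b (φ (v , h))) (does-isRollOf? {suc k} S v h)) ⟩
    Σℚ vs (λ v → whenℚ (lookup S h ∧ arrangement S′ v) (φ (v , h)))
      ≡⟨ Σℚ-cong vs (λ v → whenℚ-∧ (lookup S h) (arrangement S′ v)) ⟩
    Σℚ vs (λ v → whenℚ (lookup S h) (whenℚ (arrangement S′ v) (φ (v , h))))
      ≡⟨ Σℚ-whenℚ (lookup S h) vs (λ v → whenℚ (arrangement S′ v) (φ (v , h))) ⟩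
    whenℚ (lookup S h) (Σℚ vs (λ v → whenℚ (arrangement S′ v) (φ (v , h))))
      ≡⟨ whenℚ-cong (lookup S h) (λ Sh → trans
           (Σℚ-cong vs (λ v → whenℚ-cong (arrangement S′ v) (same Sh v)))
           (Σℚ-arrangements k S′ (card′ Sh) (G (rank S h)))) ⟩
    whenℚ (lookup S h) (ι (+ (k !)) ℚ.* G (rank S h)) ∎
    where
    S′ = S [ h ]≔ outside
    card′ : T (lookup S h) → ∣ S′ ∣ ≡ k
    card′ Sh = ℕ.suc-injective (trans (card-remove S h Sh) card)
    same : T (lookup S h) → ∀ v → T (arrangement S′ v) → φ (v , h) ≡ G (rank S h)
    same Sh v t = cong₂ ω
      (trans (sorted-arrangement S′ v t (card′ Sh)) (elements-remove S h Sh))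
      (trans (count-arrangement S′ v h t (card′ Sh)) (rank-remove-self S h))

-- Real inequalities

p≤p+q : ∀ {p q} → 0ℚ ℚ.< q → p ℚ.≤ p ℚ.+ q
p≤p+q {p} {q} 0<q = subst (ℚ._≤ p ℚ.+ q) (ℚ.+-identityʳ p) (ℚ.+-monoʳ-≤ p (ℚ.<⇒≤ 0<q))

half-pos : ∀ {δ} → 0ℚ ℚ.< δ → 0ℚ ℚ.< ½ ℚ.* δ
half-pos {δ} 0<δ = ℚ.positive⁻¹ _ {{ℚ.pos*pos⇒pos ½ δ {{ℚ.positive 0<δ}}}}

shrink : ∀ c → 0ℚ ℚ.≤ c → ∀ δ → 0ℚ ℚ.< δ → ∃[ η ] (0ℚ ℚ.< η × c ℚ.* η ℚ.≤ δ)
shrink c 0≤c δ 0<δ = η , 0<η , (begin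
  c ℚ.* η                           ≤⟨ ℚ.*-monoʳ-≤-nonNeg η {{ℚ.pos⇒nonNeg η {{ℚ.positive 0<η}}}} (p≤p+q {c} {1ℚ} (ℚ.positive⁻¹ 1ℚ)) ⟩
  c′ ℚ.* (ℚ.1/ c′ ℚ.* δ)            ≡⟨ ℚ.*-assoc c′ (ℚ.1/ c′) δ ⟨
  (c′ ℚ.* ℚ.1/ c′) ℚ.* δ            ≡⟨ cong (ℚ._* δ) (ℚ.*-inverseʳ c′) ⟩
  1ℚ ℚ.* δ                          ≡⟨ ℚ.*-identityˡ δ ⟩
  δ                                 ∎)
  where
  open ℚ.≤-Reasoning
  -- Adding 1 makes the divisor positive when `c` is 0.
  c′ = c ℚ.+ 1ℚ
  instance
    c′-pos : ℚ.Positive c′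
    c′-pos = ℚ.nonNeg+pos⇒pos c {{ℚ.nonNegative 0≤c}} 1ℚ
    c′-nz : ℚ.NonZero c′
    c′-nz = ℚ.pos⇒nonZero c′
  η = ℚ.1/ c′ ℚ.* δ
  0<η : 0ℚ ℚ.< η
  0<η = ℚ.positive⁻¹ η {{ℚ.pos*pos⇒pos (ℚ.1/ c′) {{ℚ.1/pos⇒pos c′}} δ {{ℚ.positive 0<δ}}}}

add-halves : ∀ p δ → (p ℚ.+ ½ ℚ.* δ) ℚ.+ ½ ℚ.* δ ≡ p ℚ.+ δ
add-halves = solve 2 (λ p δ → (p :+ con ½ :* δ) :+ con ½ :* δ := p :+ δ) refl
  where open +-*-Solver

≡⇒≤ℝ : ∀ {x y} → (∀ j → seq x j ≡ seq y j) → x ≤ℝ y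
≡⇒≤ℝ {x} {y} eq δ 0<δ = 0 , λ j _ → subst (ℚ._≤ seq y j ℚ.+ δ) (sym (eq j)) (p≤p+q 0<δ)

fromℚ-mono : ∀ {p q} → p ℚ.≤ q → fromℚ p ≤ℝ fromℚ q
fromℚ-mono p≤q δ 0<δ = 0 , λ _ _ → ℚ.≤-trans p≤q (p≤p+q 0<δ)

≤ℝ-trans : ∀ {x y z} → x ≤ℝ y → y ≤ℝ z → x ≤ℝ z
≤ℝ-trans {x} {y} {z} x≤y y≤z δ 0<δ
  with x≤y (½ ℚ.* δ) (half-pos 0<δ) | y≤z (½ ℚ.* δ) (half-pos 0<δ)
... | M₁ , h₁ | M₂ , h₂ = M₁ ⊔ M₂ , λ j M≤j → begin
  seq x j                                  ≤⟨ h₁ j (ℕ.m⊔n≤o⇒m≤o M₁ M₂ M≤j) ⟩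
  seq y j ℚ.+ ½ ℚ.* δ                      ≤⟨ ℚ.+-monoˡ-≤ (½ ℚ.* δ) (h₂ j (ℕ.m⊔n≤o⇒n≤o M₁ M₂ M≤j)) ⟩
  (seq z j ℚ.+ ½ ℚ.* δ) ℚ.+ ½ ℚ.* δ        ≡⟨ add-halves (seq z j) δ ⟩
  seq z j ℚ.+ δ                            ∎
  where open ℚ.≤-Reasoning

+ℝ-mono : ∀ {x x′ y y′} → x ≤ℝ x′ → y ≤ℝ y′ → x +ℝ y ≤ℝ x′ +ℝ y′
+ℝ-mono {x} {x′} {y} {y′} x≤ y≤ δ 0<δ
  with x≤ (½ ℚ.* δ) (half-pos 0<δ) | y≤ (½ ℚ.* δ) (half-pos 0<δ)
... | M₁ , h₁ | M₂ , h₂ = M₁ ⊔ M₂ , λ j M≤j → begin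
  seq x j ℚ.+ seq y j
    ≤⟨ ℚ.+-mono-≤ (h₁ j (ℕ.m⊔n≤o⇒m≤o M₁ M₂ M≤j)) (h₂ j (ℕ.m⊔n≤o⇒n≤o M₁ M₂ M≤j)) ⟩
  (seq x′ j ℚ.+ ½ ℚ.* δ) ℚ.+ (seq y′ j ℚ.+ ½ ℚ.* δ)
    ≡⟨ collect (seq x′ j) (seq y′ j) δ ⟩
  (seq x′ j ℚ.+ seq y′ j) ℚ.+ δ ∎
  where
  open ℚ.≤-Reasoning
  open +-*-Solver
  collect : ∀ a b δ → (a ℚ.+ ½ ℚ.* δ) ℚ.+ (b ℚ.+ ½ ℚ.* δ) ≡ (a ℚ.+ b) ℚ.+ δ
  collect = solve 3 (λ a b δ → (a :+ con ½ :* δ) :+ (b :+ con ½ :* δ) := (a :+ b) :+ δ) refl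

∑-mono : ∀ {A : Set} (xs : List A) {f g : A → ℝ} → (∀ {a} → a ∈ˡ xs → f a ≤ℝ g a) → ∑ xs f ≤ℝ ∑ xs g
∑-mono []       f≤g = fromℚ-mono ℚ.≤-refl
∑-mono (x ∷ xs) {f} {g} f≤g =
  +ℝ-mono {f x} {g x} {∑ xs f} {∑ xs g} (f≤g (here refl)) (∑-mono xs {f} {g} (f≤g ∘ there))

seq-∑ : ∀ {A : Set} (xs : List A) (f : A → ℝ) j → seq (∑ xs f) j ≡ Σℚ xs (λ a → seq (f a) j)
seq-∑ []       f j = refl
seq-∑ (x ∷ xs) f j = cong (λ z → seq (f x) j ℚ.+ z) (seq-∑ xs f j)

*ℝ-monoʳ : ∀ {c x y} → 0ℚ ℚ.≤ c → x ≤ℝ y → fromℚ c *ℝ x ≤ℝ fromℚ c *ℝ y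
*ℝ-monoʳ {c} {x} {y} 0≤c x≤y δ 0<δ =
  let η , 0<η , cη≤δ = shrink c 0≤c δ 0<δ
      M , h = x≤y η 0<η
  in M , λ j M≤j → begin
  c ℚ.* seq x j                  ≤⟨ ℚ.*-monoˡ-≤-nonNeg c {{ℚ.nonNegative 0≤c}} (h j M≤j) ⟩
  c ℚ.* (seq y j ℚ.+ η)          ≡⟨ ℚ.*-distribˡ-+ c (seq y j) η ⟩
  c ℚ.* seq y j ℚ.+ c ℚ.* η      ≤⟨ ℚ.+-monoʳ-≤ (c ℚ.* seq y j) cη≤δ ⟩
  c ℚ.* seq y j ℚ.+ δ            ∎
  where open ℚ.≤-Reasoning

-- A nonnegative real may be represented by slightly negative rationals. Eventually they exceed -η,
-- and η is chosen so that the error (q - p)η is at most δ.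
*ℝ-monoˡ-nonNeg : ∀ {x p q} → 0ℝ ≤ℝ x → p ℚ.≤ q → x *ℝ fromℚ p ≤ℝ x *ℝ fromℚ q
*ℝ-monoˡ-nonNeg {x} {p} {q} 0≤x p≤q δ 0<δ =
  let η , 0<η , dη≤δ = shrink (q ℚ.- p) 0≤q-p δ 0<δ
      M , h = 0≤x η 0<η
  in M , λ j M≤j → begin
  seq x j ℚ.* p                                             ≡⟨ ℚ.+-identityʳ _ ⟨
  seq x j ℚ.* p ℚ.+ 0ℚ                                      ≡⟨ cong (λ z → seq x j ℚ.* p ℚ.+ z) (ℚ.*-zeroʳ (q ℚ.- p)) ⟨
  seq x j ℚ.* p ℚ.+ (q ℚ.- p) ℚ.* 0ℚ
    ≤⟨ ℚ.+-monoʳ-≤ (seq x j ℚ.* p) (ℚ.*-monoˡ-≤-nonNeg (q ℚ.- p) {{ℚ.nonNegative 0≤q-p}} (h j M≤j)) ⟩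
  seq x j ℚ.* p ℚ.+ (q ℚ.- p) ℚ.* (seq x j ℚ.+ η)           ≡⟨ collect (seq x j) p q η ⟩
  seq x j ℚ.* q ℚ.+ (q ℚ.- p) ℚ.* η                         ≤⟨ ℚ.+-monoʳ-≤ (seq x j ℚ.* q) dη≤δ ⟩
  seq x j ℚ.* q ℚ.+ δ                                       ∎
  where
  open ℚ.≤-Reasoning
  open +-*-Solver
  0≤q-p : 0ℚ ℚ.≤ q ℚ.- p
  0≤q-p = subst (ℚ._≤ q ℚ.- p) (ℚ.+-inverseʳ p) (ℚ.+-monoˡ-≤ (ℚ.- p) p≤q)
  collect : ∀ x p q η → x ℚ.* p ℚ.+ (q ℚ.- p) ℚ.* (x ℚ.+ η) ≡ x ℚ.* q ℚ.+ (q ℚ.- p) ℚ.* η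
  collect = solve 4 (λ x p q η → x :* p :+ (q :- p) :* (x :+ η) := x :* q :+ (q :- p) :* η) refl

-- From strategies to algorithms

Σ<-const : ∀ n B → Σ< n (λ _ → + B) ≡ + (n * B)
Σ<-const zero    B = refl
Σ<-const (suc n) B = cong (λ z → + B ℤ.+ z) (Σ<-const n B)

Σℚ-select : ∀ n (f : ℕ → ℚ) r j → r < n →
  Σℚ (allFin n) (λ g → f (toℕ g) ℚ.* seq (if does (toℕ g ℕ.≟ r) then 1ℝ else 0ℝ) j) ≡ f r
Σℚ-select (suc n) f zero j r<n = begin
  Σℚ (allFin (suc n)) (λ g → f (toℕ g) ℚ.* seq (if does (toℕ g ℕ.≟ 0) then 1ℝ else 0ℝ) j)
    ≡⟨ Σℚ-allFin n (λ g → f (toℕ g) ℚ.* seq (if does (toℕ g ℕ.≟ 0) then 1ℝ else 0ℝ) j) ⟩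
  f 0 ℚ.* 1ℚ ℚ.+ Σℚ (allFin n) (λ g → f (suc (toℕ g)) ℚ.* 0ℚ)
    ≡⟨ cong₂ ℚ._+_ (ℚ.*-identityʳ (f 0))
         (trans (Σℚ-cong (allFin n) (λ g → ℚ.*-zeroʳ (f (suc (toℕ g))))) (Σℚ-zero (allFin n))) ⟩
  f 0 ℚ.+ 0ℚ ≡⟨ ℚ.+-identityʳ (f 0) ⟩
  f 0 ∎
  where open ≡-Reasoning
Σℚ-select (suc n) f (suc r) j (s≤s r<n) = begin
  Σℚ (allFin (suc n)) (λ g → f (toℕ g) ℚ.* seq (if does (toℕ g ℕ.≟ suc r) then 1ℝ else 0ℝ) j)
    ≡⟨ Σℚ-allFin n (λ g → f (toℕ g) ℚ.* seq (if does (toℕ g ℕ.≟ suc r) then 1ℝ else 0ℝ) j) ⟩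
  f 0 ℚ.* 0ℚ ℚ.+ Σℚ (allFin n) (λ g → f (suc (toℕ g)) ℚ.* seq (if does (toℕ g ℕ.≟ r) then 1ℝ else 0ℝ) j)
    ≡⟨ cong₂ ℚ._+_ (ℚ.*-zeroʳ (f 0)) (Σℚ-select n (f ∘ suc) r j r<n) ⟩
  0ℚ ℚ.+ f (suc r) ≡⟨ ℚ.+-identityˡ (f (suc r)) ⟩
  f (suc r) ∎
  where open ≡-Reasoning

length-insert : ∀ x xs → length (insert x xs) ≡ suc (length xs)
length-insert x []       = refl
length-insert x (y ∷ ys) with does (x ℕ.≤? y)
... | true  = refl
... | false = cong suc (length-insert x ys)

length-sorted : ∀ {N k} (v : Vec (Fin N) k) → length (sorted v) ≡ k
length-sorted []      = refl
length-sorted (x ∷ v) = trans (length-insert (toℕ x) (sorted v)) (cong suc (length-sorted v))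

module Exploit {k L B : ℕ} .{{_ : ℕ.NonZero B}} (s : Strategy k L B) where
  open Strategy s

  n : ℕ
  n = suc k

  instance
    nB≢0 : ℕ.NonZero (n * B)
    nB≢0 = ℕ.m*n≢0 n B

  -- Abstract, to keep the normal forms of fractions out of conversion checks.
  abstract
    u : ℚ
    u = 1ℤ ℚ./ (n * B)

    u-pos : ℚ.Positive u
    u-pos = ℚ.normalize-pos 1 (n * B)

    unit : u ℚ.* ι (+ (n * B)) ≡ 1ℚ
    unit = trans (ℚ.*-comm (1ℤ ℚ./ (n * B)) (ι (+ (n * B)))) (ι-inverse (n * B))

  -- With `u` = 1/(nB) this is 1/n + q/(nB), where q is the excess; ∣q∣ ≤ B keeps it nonnegative.
  chance : List ℕ → ℕ → ℚ
  chance X i = u ℚ.* ι (+ B ℤ.+ play X i)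

  -- Used twice: with a constant family for the total probability of one position, and with the
  -- removals from a set for the reward earned on it.
  Σ-chance : ∀ (F : ℕ → List ℕ) → Σℚ (allFin n) (λ i → chance (F (toℕ i)) (toℕ i)) ≡
             u ℚ.* ι (+ (n * B) ℤ.+ Σ< n (λ i → play (F i) i))
  Σ-chance F = begin
    Σℚ (allFin n) (λ i → u ℚ.* ι (+ B ℤ.+ play (F (toℕ i)) (toℕ i)))
      ≡⟨ Σℚ-* (allFin n) u (λ i → ι (+ B ℤ.+ play (F (toℕ i)) (toℕ i))) ⟩
    u ℚ.* Σℚ (allFin n) (λ i → ι (+ B ℤ.+ play (F (toℕ i)) (toℕ i)))
      ≡⟨ cong (u ℚ.*_) (Σℚ-ι n (λ i → + B ℤ.+ play (F i) i)) ⟩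
    u ℚ.* ι (Σ< n (λ i → + B ℤ.+ play (F i) i))
      ≡⟨ cong (λ z → u ℚ.* ι z) (trans (Σ<-+ n (λ _ → + B) (λ i → play (F i) i))
           (cong (λ z → z ℤ.+ Σ< n (λ i → play (F i) i)) (Σ<-const n B))) ⟩
    u ℚ.* ι (+ (n * B) ℤ.+ Σ< n (λ i → play (F i) i)) ∎
    where open ≡-Reasoning

  chance-nonneg : ∀ X i → 0ℚ ℚ.≤ chance X i
  chance-nonneg X i = subst (ℚ._≤ chance X i) (ℚ.*-zeroʳ u)
    (ℚ.*-monoˡ-≤-nonNeg u {{ℚ.pos⇒nonNeg u {{u-pos}}}} (ι-mono-≤ {0ℤ} (nonneg (play X i) (bounded X i))))
    where
    nonneg : ∀ z → ℤ.∣ z ∣ ≤ B → 0ℤ ℤ.≤ + B ℤ.+ z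
    nonneg (+ m)    le = ℤ.+≤+ z≤n
    nonneg -[1+ m ] le = subst (0ℤ ℤ.≤_) (sym (ℤ.⊖-≥ le)) (ℤ.+≤+ z≤n)

  algorithm : ∀ N → Algorithm n N
  algorithm N v = record
    { weight      = λ g → fromℚ (chance (sorted v) (toℕ g))
    ; nonnegative = λ {g} _ → fromℚ-mono (chance-nonneg (sorted v) (toℕ g))
    ; total       = ≡⇒≤ℝ {∑ (allFin n) w} {1ℝ} sum , ≡⇒≤ℝ {1ℝ} {∑ (allFin n) w} (sym ∘ sum)
    }
    where
    open ≡-Reasoning
    w : Fin n → ℝ
    w g = fromℚ (chance (sorted v) (toℕ g))
    sum : ∀ j → seq (∑ (allFin n) w) j ≡ 1ℚ
    sum j = begin
      seq (∑ (allFin n) w) j                                    ≡⟨ seq-∑ (allFin n) w j ⟩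
      Σℚ (allFin n) (λ g → chance (sorted v) (toℕ g))           ≡⟨ Σ-chance (λ _ → sorted v) ⟩
      u ℚ.* ι (+ (n * B) ℤ.+ Σ< n (play (sorted v)))
        ≡⟨ cong (λ z → u ℚ.* ι (+ (n * B) ℤ.+ z)) (balanced (sorted v) (length-sorted v)) ⟩
      u ℚ.* ι (+ (n * B) ℤ.+ 0ℤ)                                ≡⟨ cong (λ z → u ℚ.* ι z) (ℤ.+-identityʳ (+ (n * B))) ⟩
      u ℚ.* ι (+ (n * B))                                       ≡⟨ unit ⟩
      1ℚ                                                        ∎

  module _ {N : ℕ} (N≤L : N ≤ L) where

    A : Algorithm n N
    A = algorithm N

    count-≤ : ∀ {m} (h : Fin N) (v : Vec (Fin N) m) → Vec.count (Fin._<? h) v ≤ m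
    count-≤ h = Vec.count≤n (Fin._<? h)

    seq-rewardOnRoll : ∀ ρ j → seq (rewardOnRoll A ρ) j ≡ chance (sorted (proj₁ ρ)) (hiddenRank {n} ρ)
    seq-rewardOnRoll ρ@(v , h) j = trans
      (seq-∑ (allFin n) (λ g → weight (A v) g *ℝ reward {n} ρ g) j)
      (Σℚ-select n (chance (sorted v)) (hiddenRank {n} ρ) j (s≤s (count-≤ h v)))

    n!≢0 : ℕ.NonZero (n !)
    n!≢0 = n ℕ.!≢0

    1/n! : ℚ
    1/n! = (1ℤ ℚ./ (n !)) {{n!≢0}}

    setReward : Subset N → ℚ
    setReward S = 1/n! ℚ.* Σℚ (rolls n S) (λ ρ → chance (sorted (proj₁ ρ)) (hiddenRank {n} ρ))

    seq-rewardOnSet : ∀ S j → seq (rewardOnSet A S) j ≡ setReward S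
    seq-rewardOnSet S j = cong (1/n! ℚ.*_)
      (trans (seq-∑ (rolls n S) (rewardOnRoll A) j) (Σℚ-cong (rolls n S) (λ ρ → seq-rewardOnRoll ρ j)))

    -- The number (1 + u)/n, in the shape in which a sum over rolls produces it.
    guaranteed : ℚ
    guaranteed = 1/n! ℚ.* (ι (+ (k !)) ℚ.* (1ℚ ℚ.+ u))

    guaranteed-value : ι (+ n) ℚ.* guaranteed ≡ 1ℚ ℚ.+ u
    guaranteed-value = cancel (ι (+ n)) 1/n! (ι (+ (k !))) (1ℚ ℚ.+ u)
      (trans (cong (ℚ._* 1/n!) (trans (sym (ι-* (+ n) (+ (k !)))) (cong ι (sym (ℤ.pos-* n (k !))))))
             (ι-inverse (n !) {{n!≢0}}))
      where
      cancel : ∀ a b c x → (a ℚ.* c) ℚ.* b ≡ 1ℚ → a ℚ.* (b ℚ.* (c ℚ.* x)) ≡ x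
      cancel a b c x one =
        trans (regroup a b c x) (trans (cong (ℚ._* x) one) (ℚ.*-identityˡ x))
        where
        open +-*-Solver
        regroup : ∀ a b c x → a ℚ.* (b ℚ.* (c ℚ.* x)) ≡ ((a ℚ.* c) ℚ.* b) ℚ.* x
        regroup = solve 4 (λ a b c x → a :* (b :* (c :* x)) := ((a :* c) :* b) :* x) refl

    setReward-≥ : ∀ S → ∣ S ∣ ≡ n → guaranteed ℚ.≤ setReward S
    setReward-≥ S card = ℚ.*-monoˡ-≤-nonNeg 1/n! {{ℚ.pos⇒nonNeg 1/n! {{ℚ.normalize-pos 1 (n !) {{n!≢0}}}}}} (begin
      ι (+ (k !)) ℚ.* (1ℚ ℚ.+ u)
        ≤⟨ ℚ.*-monoˡ-≤-nonNeg (ι (+ (k !))) {{ℚ.nonNegative (0≤ι (k !))}} gain ⟩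
      ι (+ (k !)) ℚ.* Σℚ (allFin n) (λ i → chance (remove (toℕ i) E) (toℕ i))
        ≡⟨ Σℚ-rolls k S card chance ⟨
      Σℚ (rolls n S) (λ ρ → chance (sorted (proj₁ ρ)) (hiddenRank {n} ρ)) ∎)
      where
      open ℚ.≤-Reasoning
      E = elements S
      e = Σ< n (λ i → play (remove i E) i)
      gain : 1ℚ ℚ.+ u ℚ.≤ Σℚ (allFin n) (λ i → chance (remove (toℕ i) E) (toℕ i))
      gain = begin
        1ℚ ℚ.+ u                              ≡⟨ cong₂ ℚ._+_ unit (ℚ.*-identityʳ u) ⟨
        u ℚ.* ι (+ (n * B)) ℚ.+ u ℚ.* ι 1ℤ    ≡⟨ ℚ.*-distribˡ-+ u (ι (+ (n * B))) (ι 1ℤ) ⟨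
        u ℚ.* (ι (+ (n * B)) ℚ.+ ι 1ℤ)        ≡⟨ cong (u ℚ.*_) (ι-+ (+ (n * B)) 1ℤ) ⟨
        u ℚ.* ι (+ (n * B) ℤ.+ 1ℤ)
          ≤⟨ ℚ.*-monoˡ-≤-nonNeg u {{ℚ.pos⇒nonNeg u {{u-pos}}}} (ι-mono-≤ (ℤ.+-monoʳ-≤ (+ (n * B))
               (gainful E (trans (length-elements S) card) (elements-Increasing S)
                 (All.map (λ x<N → ℕ.<-≤-trans x<N N≤L) (elements-< S))))) ⟩
        u ℚ.* ι (+ (n * B) ℤ.+ e)             ≡⟨ Σ-chance (λ i → remove i E) ⟨
        Σℚ (allFin n) (λ i → chance (remove (toℕ i) E) (toℕ i)) ∎

    -- Each set earns at least (1 + u)/n. Averaging over `F`, whose weights are nonnegative and sum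
    -- to 1, gives 1 + u ≤ 1 + ε.
    hard⇒unit≤ : ∀ {ε} → Hard (suc k) ε N → fromℚ u ≤ℝ ε
    hard⇒unit≤ {ε} (F , low) δ 0<δ =
      let M , h = bound δ 0<δ in M , λ j M≤j → begin
      u                                       ≡⟨ cancel₁ u ⟩
      (1ℚ ℚ.+ u) ℚ.* 1ℚ ℚ.- 1ℚ                ≤⟨ ℚ.+-monoˡ-≤ (ℚ.- 1ℚ) (h j M≤j) ⟩
      ((1ℚ ℚ.+ seq ε j) ℚ.+ δ) ℚ.- 1ℚ         ≡⟨ cancel₂ (seq ε j) δ ⟩
      seq ε j ℚ.+ δ                           ∎
      where
      open ℚ.≤-Reasoning
      open +-*-Solver
      Ss = subsetsOfSize n N
      share : Subset N → ℝ
      share S = weight F S *ℝ fromℚ guaranteed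
      c : ℚ
      c = 1ℚ ℚ.+ u
      c-nonneg : 0ℚ ℚ.≤ c
      c-nonneg = ℚ.<⇒≤ (ℚ.positive⁻¹ c {{ℚ.pos+pos⇒pos 1ℚ u {{u-pos}}}})
      step₁ : fromℚ c *ℝ 1ℝ ≤ℝ fromℚ c *ℝ ∑ Ss (weight F)
      step₁ = *ℝ-monoʳ {c} {1ℝ} {∑ Ss (weight F)} c-nonneg (proj₂ (total F))
      step₂ : fromℚ c *ℝ ∑ Ss (weight F) ≤ℝ fromℕ n *ℝ ∑ Ss share
      step₂ = ≡⇒≤ℝ {fromℚ c *ℝ ∑ Ss (weight F)} {fromℕ n *ℝ ∑ Ss share} λ j → begin-equality
        c ℚ.* seq (∑ Ss (weight F)) j
          ≡⟨ cong₂ ℚ._*_ (sym guaranteed-value) (seq-∑ Ss (weight F) j) ⟩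
        (ι (+ n) ℚ.* guaranteed) ℚ.* Σℚ Ss (λ S → seq (weight F S) j)
          ≡⟨ ℚ.*-assoc (ι (+ n)) guaranteed _ ⟩
        ι (+ n) ℚ.* (guaranteed ℚ.* Σℚ Ss (λ S → seq (weight F S) j))
          ≡⟨ cong (ι (+ n) ℚ.*_) (Σℚ-* Ss guaranteed (λ S → seq (weight F S) j)) ⟨
        ι (+ n) ℚ.* Σℚ Ss (λ S → guaranteed ℚ.* seq (weight F S) j)
          ≡⟨ cong (ι (+ n) ℚ.*_) (Σℚ-cong Ss (λ S → ℚ.*-comm guaranteed (seq (weight F S) j))) ⟩
        ι (+ n) ℚ.* Σℚ Ss (λ S → seq (share S) j)
          ≡⟨ cong (ι (+ n) ℚ.*_) (seq-∑ Ss share j) ⟨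
        ι (+ n) ℚ.* seq (∑ Ss share) j ∎
      step₃ : fromℕ n *ℝ ∑ Ss share ≤ℝ fromℕ n *ℝ expectedReward F A
      step₃ = *ℝ-monoʳ {ι (+ n)} {∑ Ss share} {expectedReward F A} (0≤ι n)
        (∑-mono Ss {share} λ {S} S∈ → ≤ℝ-trans {share S} {weight F S *ℝ fromℚ (setReward S)} {weight F S *ℝ rewardOnSet A S}
          (*ℝ-monoˡ-nonNeg {weight F S} (nonnegative F S∈)
            (setReward-≥ S (proj₂ (∈-filter⁻ (λ S → ∣ S ∣ ℕ.≟ n) {xs = vectors (inside ∷ outside ∷ []) N} S∈))))
          (≡⇒≤ℝ {weight F S *ℝ fromℚ (setReward S)} {weight F S *ℝ rewardOnSet A S}
            (λ j → cong (seq (weight F S) j ℚ.*_) (sym (seq-rewardOnSet S j)))))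
      bound : fromℚ c *ℝ 1ℝ ≤ℝ 1ℝ +ℝ ε
      bound = ≤ℝ-trans {fromℚ c *ℝ 1ℝ} {fromℕ n *ℝ ∑ Ss share} {1ℝ +ℝ ε}
        (≤ℝ-trans {fromℚ c *ℝ 1ℝ} {fromℚ c *ℝ ∑ Ss (weight F)} {fromℕ n *ℝ ∑ Ss share} step₁ step₂)
        (≤ℝ-trans {fromℕ n *ℝ ∑ Ss share} {fromℕ n *ℝ expectedReward F A} {1ℝ +ℝ ε} step₃ (low A))
      cancel₁ : ∀ u → u ≡ (1ℚ ℚ.+ u) ℚ.* 1ℚ ℚ.- 1ℚ
      cancel₁ = solve 1 (λ u → u := (con 1ℚ :+ u) :* con 1ℚ :- con 1ℚ) refl
      cancel₂ : ∀ e δ → ((1ℚ ℚ.+ e) ℚ.+ δ) ℚ.- 1ℚ ≡ e ℚ.+ δ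
      cancel₂ = solve 2 (λ e δ → ((con 1ℚ :+ e) :+ δ) :- con 1ℚ := e :+ δ) refl

-- Towers

toℚᵘ-≤ι : ∀ {r M} → r ℚ.≤ ι (+ M) → ℚ.↥ r ℤ.≤ + (M * ℚ.↧ₙ r)
toℚᵘ-≤ι {r@(ℚ.mkℚ a d _)} {M} r≤M with ℚᵘ.≤-respʳ-≃ (toℚᵘ-ι (+ M)) (ℚ.toℚᵘ-mono-≤ r≤M)
... | *≤* le = subst (ℤ._≤ + (M * suc d)) (ℤ.*-identityʳ a)
                 (subst (a ℤ.* 1ℤ ℤ.≤_) (sym (ℤ.pos-* M (suc d))) le)

r≤ι∣↥r∣ : ∀ r → r ℚ.≤ ι (+ ℤ.∣ ℚ.↥ r ∣)
r≤ι∣↥r∣ r@(ℚ.mkℚ a d _) =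
  ℚ.toℚᵘ-cancel-≤ (ℚᵘ.≤-respʳ-≃ (ℚᵘ.≃-sym (toℚᵘ-ι (+ ℤ.∣ a ∣))) (*≤* (ℤ.≤-trans
    (ℤ.*-monoʳ-≤-nonNeg 1ℤ (below a))
    (ℤ.*-monoˡ-≤-nonNeg (+ ℤ.∣ a ∣) (ℤ.+≤+ (s≤s z≤n))))))
  where
  below : ∀ z → z ℤ.≤ + ℤ.∣ z ∣
  below (+ k)    = ℤ.≤-refl
  below -[1+ k ] = ℤ.-≤+

^ℚ-ι : ∀ k d → ι (+ k) ^ℚ d ≡ ι (+ (k ^ d))
^ℚ-ι k zero    = refl
^ℚ-ι k (suc d) = begin
  ι (+ k) ℚ.* ι (+ k) ^ℚ d        ≡⟨ cong (ι (+ k) ℚ.*_) (^ℚ-ι k d) ⟩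
  ι (+ k) ℚ.* ι (+ (k ^ d))       ≡⟨ ι-* (+ k) (+ (k ^ d)) ⟨
  ι (+ k ℤ.* + (k ^ d))           ≡⟨ cong ι (ℤ.pos-* k (k ^ d)) ⟨
  ι (+ (k ^ suc d))               ∎
  where open ≡-Reasoning

^ℚ-nonneg : ∀ {p} d → 0ℚ ℚ.≤ p → 0ℚ ℚ.≤ p ^ℚ d
^ℚ-nonneg     zero    0≤p = ℚ.<⇒≤ (ℚ.positive⁻¹ 1ℚ)
^ℚ-nonneg {p} (suc d) 0≤p = ℚ.nonNegative⁻¹ _
  {{ℚ.nonNeg*nonNeg⇒nonNeg p {{ℚ.nonNegative 0≤p}} (p ^ℚ d) {{ℚ.nonNegative (^ℚ-nonneg d 0≤p)}}}}

^ℚ-mono : ∀ {p q} d → 0ℚ ℚ.≤ p → p ℚ.≤ q → p ^ℚ d ℚ.≤ q ^ℚ d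
^ℚ-mono         zero    0≤p p≤q = ℚ.≤-refl
^ℚ-mono {p} {q} (suc d) 0≤p p≤q = ℚ.≤-trans
  (ℚ.*-monoʳ-≤-nonNeg (p ^ℚ d) {{ℚ.nonNegative (^ℚ-nonneg d 0≤p)}} p≤q)
  (ℚ.*-monoˡ-≤-nonNeg q {{ℚ.nonNegative (ℚ.≤-trans 0≤p p≤q)}} (^ℚ-mono d 0≤p p≤q))

2^ℤ-≤ : ∀ z M → z ℤ.≤ + M → 2^ℤ z ℚ.≤ ι (+ (2 ^ M))
2^ℤ-≤ (+ k) M (ℤ.+≤+ k≤M) =
  subst (ℚ._≤ ι (+ (2 ^ M))) (sym (^ℚ-ι 2 k)) (ι-mono-≤ {+ (2 ^ k)} {+ (2 ^ M)} (ℤ.+≤+ (ℕ.^-monoʳ-≤ 2 k≤M)))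
2^ℤ-≤ -[1+ k ] M _ = ℚ.≤-trans (½^≤1 (suc k)) (ι-mono-≤ {1ℤ} {+ (2 ^ M)} (ℤ.+≤+ (ℕ.m^n>0 2 M)))
  where
  ½^≤1 : ∀ j → ½ ^ℚ j ℚ.≤ 1ℚ
  ½^≤1 zero    = ℚ.≤-refl
  ½^≤1 (suc j) = ℚ.≤-trans (ℚ.*-monoˡ-≤-nonNeg ½ (½^≤1 j)) (toWitness {a? = (½ ℚ.* 1ℚ) ℚ.≤? 1ℚ} _)

-- Compare `d`-th powers, `d` being the denominator of `r`: if q exceeded 2^M, then q^d < 2^(Md) =
-- (2^M)^d ≤ q^d.
<2^-bound : ∀ {q r M} → q <2^ r → r ℚ.≤ ι (+ M) → q ℚ.≤ ι (+ (2 ^ M))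
<2^-bound {q} {r} {M} q<2^r r≤M with q ℚ.≤? ι (+ (2 ^ M))
... | yes le = le
... | no ¬le = contradiction (ℚ.<-≤-trans (q<2^r 0≤q) (begin
  2^ℤ (ℚ.↥ r)                   ≤⟨ 2^ℤ-≤ (ℚ.↥ r) (M * d) (toℚᵘ-≤ι {r} {M} r≤M) ⟩
  ι (+ (2 ^ (M * d)))           ≡⟨ cong (λ k → ι (+ k)) (ℕ.^-*-assoc 2 M d) ⟨
  ι (+ ((2 ^ M) ^ d))           ≡⟨ ^ℚ-ι (2 ^ M) d ⟨
  ι (+ (2 ^ M)) ^ℚ d            ≤⟨ ^ℚ-mono d 0≤2^M (ℚ.<⇒≤ 2^M<q) ⟩
  q ^ℚ d                        ∎)) (ℚ.<-irrefl refl)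
  where
  open ℚ.≤-Reasoning
  d = ℚ.↧ₙ r
  2^M<q = ℚ.≰⇒> ¬le
  0≤2^M = 0≤ι (2 ^ M)
  0≤q = ℚ.≤-trans 0≤2^M (ℚ.<⇒≤ 2^M<q)

-- The rational `r` at the foot of the tower is found first, and the bound holds for every natural
-- `K` above it, so that `K` can then be `r` rounded up. Each exponential is passed by `<2^-bound`.
tower-bound : ∀ m L {q} → tower m L q →
              ∃[ r ] (L r × (∀ K → r ℚ.≤ ι (+ K) → q ℚ.≤ ι (+ tower2 m K)))
tower-bound zero    L {q} Lq = q , Lq , λ _ q≤K → q≤K
tower-bound (suc m) L (r′ , t , q<2^r′) =
  let r , Lr , bound = tower-bound m L t
  in r , Lr , λ K r≤K → <2^-bound {r = r′} {tower2 m K} q<2^r′ (bound K r≤K)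

-- The result is the least K ≥ 1 above `r`. If K ≥ 2, then r > K - 1 ≥ K/2, so rounding costs at
-- most a factor 2.
ceiling : ∀ r → ∃[ K ] (1 ≤ K × r ℚ.≤ ι (+ K) × (K ≡ 1 ⊎ ι (+ K) ℚ.≤ r ℚ.+ r))
ceiling r = search ℤ.∣ ℚ.↥ r ∣ (ℚ.≤-trans (r≤ι∣↥r∣ r) (ι-mono-≤ {+ ℤ.∣ ℚ.↥ r ∣} {+ suc ℤ.∣ ℚ.↥ r ∣} (ℤ.+≤+ (ℕ.n≤1+n _))))
  where
  search : ∀ M → r ℚ.≤ ι (+ suc M) → ∃[ K ] (1 ≤ K × r ℚ.≤ ι (+ K) × (K ≡ 1 ⊎ ι (+ K) ℚ.≤ r ℚ.+ r))
  search zero    r≤ = 1 , ℕ.≤-refl , r≤ , inj₁ refl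
  search (suc M) r≤ with r ℚ.≤? ι (+ suc M)
  ... | yes le = search M le
  ... | no ¬le = suc (suc M) , s≤s z≤n , r≤ , inj₂ (begin
    ι (+ suc (suc M))                  ≤⟨ ι-mono-≤ {+ suc (suc M)} {+ suc M ℤ.+ + suc M} (ℤ.+≤+ (s≤s (ℕ.m≤n+m (suc M) M))) ⟩
    ι (+ suc M ℤ.+ + suc M)            ≡⟨ ι-+ (+ suc M) (+ suc M) ⟩
    ι (+ suc M) ℚ.+ ι (+ suc M)        ≤⟨ ℚ.+-mono-≤ (ℚ.<⇒≤ (ℚ.≰⇒> ¬le)) (ℚ.<⇒≤ (ℚ.≰⇒> ¬le)) ⟩
    r ℚ.+ r                            ∎)
    where open ℚ.≤-Reasoning

-- The constant of the theorem and the final estimate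

⅛ : ℚ
⅛ = 1ℤ ℚ./ 8

-- In the application e = ε, c = C, k = K is essentially the ceiling of r, and
-- u = 1 / d is the excess earned by an algorithm.
squeeze : ∀ {c d k u r e} → 0ℚ ℚ.≤ c → 0ℚ ℚ.≤ d → 0ℚ ℚ.< u → d ℚ.* u ≡ 1ℚ → d ℚ.≤ k ℚ.* c →
          ½ ℚ.* u ℚ.≤ e → k ≡ 1ℚ ⊎ k ℚ.≤ r ℚ.+ r → c ℚ.* e ℚ.≤ ⅛ → r ℚ.* (c ℚ.* e) ℚ.≤ ⅛ →
          ½ ℚ.≤ ⅛ ℚ.+ ⅛
squeeze {c} {d} {k} {u} {r} {e} 0≤c 0≤d 0<u du≡1 d≤kc ½u≤e size y≤⅛ ry≤⅛ = ℚ.≤-trans ½≤ky (ky≤ size)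
  where
  open ℚ.≤-Reasoning
  y = c ℚ.* e
  0≤e : 0ℚ ℚ.≤ e
  0≤e = ℚ.≤-trans (ℚ.<⇒≤ (half-pos 0<u)) ½u≤e
  0≤y : 0ℚ ℚ.≤ y
  0≤y = subst (ℚ._≤ y) (ℚ.*-zeroʳ c) (ℚ.*-monoˡ-≤-nonNeg c {{ℚ.nonNegative 0≤c}} 0≤e)
  ½≤ky : ½ ℚ.≤ k ℚ.* y
  ½≤ky = begin
    ½                      ≡⟨ ℚ.*-identityʳ ½ ⟨
    ½ ℚ.* 1ℚ               ≡⟨ cong (½ ℚ.*_) du≡1 ⟨
    ½ ℚ.* (d ℚ.* u)        ≡⟨ swap ½ d u ⟩
    d ℚ.* (½ ℚ.* u)        ≤⟨ ℚ.*-monoˡ-≤-nonNeg d {{ℚ.nonNegative 0≤d}} ½u≤e ⟩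
    d ℚ.* e                ≤⟨ ℚ.*-monoʳ-≤-nonNeg e {{ℚ.nonNegative 0≤e}} d≤kc ⟩
    (k ℚ.* c) ℚ.* e        ≡⟨ ℚ.*-assoc k c e ⟩
    k ℚ.* y                ∎
    where
    open +-*-Solver
    swap : ∀ a b c → a ℚ.* (b ℚ.* c) ≡ b ℚ.* (a ℚ.* c)
    swap = solve 3 (λ a b c → a :* (b :* c) := b :* (a :* c)) refl
  -- For k = 1 the smallness of ε suffices, the reason for the choice of `ε₀`. Otherwise k ≤ 2r, and
  -- r lies below the quotient ⅛ / (Cε).
  ky≤ : k ≡ 1ℚ ⊎ k ℚ.≤ r ℚ.+ r → k ℚ.* y ℚ.≤ ⅛ ℚ.+ ⅛
  ky≤ (inj₁ refl) = begin
    1ℚ ℚ.* y               ≡⟨ ℚ.*-identityˡ y ⟩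
    y                      ≤⟨ y≤⅛ ⟩
    ⅛                      ≤⟨ p≤p+q {⅛} (ℚ.positive⁻¹ ⅛) ⟩
    ⅛ ℚ.+ ⅛                ∎
  ky≤ (inj₂ k≤2r) = begin
    k ℚ.* y                ≤⟨ ℚ.*-monoʳ-≤-nonNeg y {{ℚ.nonNegative 0≤y}} k≤2r ⟩
    (r ℚ.+ r) ℚ.* y        ≡⟨ ℚ.*-distribʳ-+ y r r ⟩
    r ℚ.* y ℚ.+ r ℚ.* y    ≤⟨ ℚ.+-mono-≤ ry≤⅛ ry≤⅛ ⟩
    ⅛ ℚ.+ ⅛                ∎

-- All three real inequalities hold from some index on. At one such index `squeeze` applies and
-- yields ½ ≤ ¼.
contradictory : ∀ {c d k u t r ε} → 0ℚ ℚ.≤ c → 0ℚ ℚ.≤ d → 0ℚ ℚ.< u → d ℚ.* u ≡ 1ℚ → d ℚ.≤ k ℚ.* c →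
                k ≡ 1ℚ ⊎ k ℚ.≤ r ℚ.+ r → c ℚ.* t ≡ ⅛ →
                fromℚ r *ℝ (fromℚ c *ℝ ε) <ℝ fromℚ ⅛ → ε <ℝ fromℚ t → ¬ fromℚ u ≤ℝ ε
contradictory {c} {d} {k} {u} {t} {r} {ε} 0≤c 0≤d 0<u du≡1 d≤kc size ct≡⅛
  (δ₁ , 0<δ₁ , M₁ , h₁) (δ₂ , 0<δ₂ , M₂ , h₂) u≤ε =
  ℚ.<-irrefl refl (ℚ.<-≤-trans (toWitness {a? = (⅛ ℚ.+ ⅛) ℚ.<? ½} _)
    (squeeze {c} {d} {k} {u} {r} {e} 0≤c 0≤d 0<u du≡1 d≤kc ½u≤e size y≤⅛ (ℚ.≤-trans (p≤p+q 0<δ₁) (h₁ j j≥₁))))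
  where
  open ℚ.≤-Reasoning
  -- A slack of half of `u` still leaves terms of ε that are at least half of `u`.
  eventually = u≤ε (½ ℚ.* u) (half-pos 0<u)
  M₃ = proj₁ eventually
  j = M₁ ⊔ M₂ ⊔ M₃
  e = seq ε j
  j≥₁ : M₁ ≤ j
  j≥₁ = ℕ.≤-trans (ℕ.m≤m⊔n M₁ M₂) (ℕ.m≤m⊔n (M₁ ⊔ M₂) M₃)
  j≥₂ : M₂ ≤ j
  j≥₂ = ℕ.≤-trans (ℕ.m≤n⊔m M₁ M₂) (ℕ.m≤m⊔n (M₁ ⊔ M₂) M₃)
  y≤⅛ : c ℚ.* e ℚ.≤ ⅛
  y≤⅛ = subst (c ℚ.* e ℚ.≤_) ct≡⅛
    (ℚ.*-monoˡ-≤-nonNeg c {{ℚ.nonNegative 0≤c}} (ℚ.≤-trans (p≤p+q 0<δ₂) (h₂ j j≥₂)))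
  ½u≤e : ½ ℚ.* u ℚ.≤ e
  ½u≤e = begin
    ½ ℚ.* u                                ≡⟨ halve u ⟩
    u ℚ.- ½ ℚ.* u                          ≤⟨ ℚ.+-monoˡ-≤ (ℚ.- (½ ℚ.* u)) (proj₂ eventually j (ℕ.m≤n⊔m (M₁ ⊔ M₂) M₃)) ⟩
    (e ℚ.+ ½ ℚ.* u) ℚ.- ½ ℚ.* u            ≡⟨ cancel e (½ ℚ.* u) ⟩
    e                                      ∎
    where
    open +-*-Solver
    halve : ∀ u → ½ ℚ.* u ≡ u ℚ.- ½ ℚ.* u
    halve = solve 1 (λ u → con ½ :* u := u :- con ½ :* u) refl
    cancel : ∀ a b → (a ℚ.+ b) ℚ.- b ≡ a
    cancel = solve 2 (λ a b → (a :+ b) :- b := a) refl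

-- The factor `n` is absorbed into one more power of `P`, which makes the exponent 1 + 2m ≤ 2n ≤ 7n.
total-cost : ∀ n P K m → n ≤ P → 2 ≤ P → 2 + m ≤ n → n * (K * (P * P) ^ m) ≤ K * P ^ (7 * n)
total-cost n P K m n≤P 2≤P m<n = begin
  n * (K * (P * P) ^ m)            ≡⟨ swap n K _ ⟩
  K * (n * (P * P) ^ m)            ≤⟨ ℕ.*-monoʳ-≤ K (ℕ.*-monoˡ-≤ ((P * P) ^ m) n≤P) ⟩
  K * (P * (P * P) ^ m)            ≡⟨ cong (λ z → K * (P * (P * z) ^ m)) (ℕ.*-identityʳ P) ⟨
  K * (P * (P ^ 2) ^ m)            ≡⟨ cong (λ z → K * (P * z)) (ℕ.^-*-assoc P 2 m) ⟩
  K * P ^ suc (2 * m)              ≤⟨ ℕ.*-monoʳ-≤ K (ℕ.^-monoʳ-≤ P {{P≢0}} exponent) ⟩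
  K * P ^ (7 * n)                  ∎
  where
  open ℕ.≤-Reasoning
  P≢0 : ℕ.NonZero P
  P≢0 = ℕ.>-nonZero (ℕ.<-≤-trans z<s 2≤P)
  swap : ∀ a b c → a * (b * c) ≡ b * (a * c)
  swap = ℕ-solve-∀
  exponent : suc (2 * m) ≤ 7 * n
  exponent = begin
    suc (2 * m)        ≤⟨ ℕ.m≤n+m (suc (2 * m)) 3 ⟩
    4 + 2 * m          ≡⟨ double m ⟩
    2 * (2 + m)        ≤⟨ ℕ.*-mono-≤ (ℕ.m≤m+n 2 5) m<n ⟩
    7 * n              ∎
    where
    double : ∀ m → 4 + 2 * m ≡ 2 * (2 + m)
    double = ℕ-solve-∀

fromℚ-pos : ∀ q → 0ℚ ℚ.< q → 0ℝ <ℝ fromℚ q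
fromℚ-pos q 0<q = q , 0<q , 0 , λ _ _ → ℚ.≤-reflexive (ℚ.+-identityˡ q)

module LowerBound (m C E : ℕ) .{{_ : ℕ.NonZero C}} .{{_ : ℕ.NonZero E}}
  (strategies : ∀ K → 1 ≤ K → Strategy (suc m) (tower2 m K) (K * E))
  (cost : ∀ K → (2 + m) * (K * E) ≤ K * C) where

  abstract
    -- Below this value Cε < ⅛, as the case K = 1 demands.
    ε₀ : ℚ
    ε₀ = (1ℤ ℚ./ C) ℚ.* ⅛

    ε₀-pos : 0ℚ ℚ.< ε₀
    ε₀-pos = ℚ.positive⁻¹ ε₀ {{ℚ.pos*pos⇒pos (1ℤ ℚ./ C) {{ℚ.normalize-pos 1 C}} ⅛}}

    Cε₀≡⅛ : ι (+ C) ℚ.* ε₀ ≡ ⅛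
    Cε₀≡⅛ = trans (sym (ℚ.*-assoc (ι (+ C)) (1ℤ ℚ./ C) ⅛))
              (trans (cong (ℚ._* ⅛) (ι-inverse C)) (ℚ.*-identityˡ ⅛))

  refute : ∀ {ε r K N} → ε <ℝ fromℚ ε₀ → Hard (suc (suc m)) ε N → 1 ≤ K → N ≤ tower2 m K →
           K ≡ 1 ⊎ ι (+ K) ℚ.≤ r ℚ.+ r → ¬ (fromℚ r *ℝ (fromℕ C *ℝ ε) <ℝ fromℚ ⅛)
  refute {ε} {r} {K} ε<ε₀ hard 1≤K N≤tower size Lr =
    contradictory {ι (+ C)} {ι (+ (n * B))} {ι (+ K)} {u} {ε₀} {r} {ε}
      (0≤ι C) (0≤ι (n * B)) u>0 inverse nB≤KC
      size′ Cε₀≡⅛ Lr ε<ε₀ u≤ε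
    where
    B : ℕ
    B = K * E
    instance
      B≢0 : ℕ.NonZero B
      B≢0 = ℕ.m*n≢0 K E {{ℕ.>-nonZero 1≤K}}
    open Exploit (strategies K 1≤K)
    nB≤KC : ι (+ (n * B)) ℚ.≤ ι (+ K) ℚ.* ι (+ C)
    u>0 : 0ℚ ℚ.< u
    u>0 = ℚ.positive⁻¹ u {{u-pos}}
    inverse : ι (+ (n * B)) ℚ.* u ≡ 1ℚ
    inverse = trans (ℚ.*-comm (ι (+ (n * B))) u) unit
    size′ : ι (+ K) ≡ 1ℚ ⊎ ι (+ K) ℚ.≤ r ℚ.+ r
    size′ = Sum.map₁ (cong (λ k → ι (+ k))) size
    u≤ε : fromℚ u ≤ℝ ε
    u≤ε = hard⇒unit≤ N≤tower {ε} hard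
    nB≤KC = ℚ.≤-trans (ι-mono-≤ {+ (n * B)} {+ (K * C)} (ℤ.+≤+ (cost K)))
      (ℚ.≤-reflexive (trans (cong ι (ℤ.pos-* K C)) (ι-* (+ K) (+ C))))

  -- If N < q for some q in the cut of the tower, then q comes from some r < ⅛ / (Cε). With `K` as
  -- `r` rounded up, N is at most the tower over `K`, so a strategy exists whose gain `refute` shows
  -- to be incompatible with ε.
  complexity : ∀ ε → ε <ℝ fromℚ ε₀ →
    CardinalComplexityAtLeast (suc (suc m)) ε (tower m (fromℚ ⅛ ÷ (fromℕ C *ℝ ε)))
  complexity ε ε<ε₀ N hard q Tq = ℚ.≮⇒≥ λ N<q →
    let r , Lr , bound           = tower-bound m (fromℚ ⅛ ÷ (fromℕ C *ℝ ε)) Tq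
        K , 1≤K , r≤K , size     = ceiling r
        N<tower                  = ι-cancel-< (ℚ.<-≤-trans N<q (bound K r≤K))
    in refute {ε} {r} {K} ε<ε₀ hard 1≤K (ℕ.<⇒≤ (ℤ.drop‿+<+ N<tower)) size Lr

corollary4p1 : ∃[ c ] (0ℝ <ℝ c × (∀ (n : ℕ) → 2 ≤ n →
    ∃[ ε₀ ] (0ℝ <ℝ ε₀ × (∀ (ε : ℝ) → 0ℝ <ℝ ε → ε <ℝ ε₀ →
    CardinalComplexityAtLeast n ε
    (tower (n ∸ 2) (c ÷ (fromℕ ((6 * n) ^ (7 * n)) *ℝ ε)))))))
-- With n = 2 + m the height n - 2 is `m`: two faces are the base case, and each further face adds
-- one exponential.
corollary4p1 = fromℚ ⅛ , fromℚ-pos ⅛ (ℚ.positive⁻¹ ⅛) , λ { (suc (suc m)) (s≤s (s≤s z≤n)) →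
    let n = suc (suc m)
        open LowerBound m ((6 * n) ^ (7 * n)) ((6 * n * (6 * n)) ^ m)
               {{ℕ.m^n≢0 (6 * n) (7 * n) {{ℕ.m*n≢0 6 n}}}}
               {{ℕ.m^n≢0 (6 * n * (6 * n)) m {{ℕ.m*n≢0 (6 * n) (6 * n) {{ℕ.m*n≢0 6 n}} {{ℕ.m*n≢0 6 n}}}}}}
               (λ K 1≤K → strategy n K 1≤K m ℕ.≤-refl)
               (λ K → total-cost n (6 * n) K m (ℕ.m≤n*m n 6)
                        (ℕ.≤-trans (s≤s (s≤s z≤n)) (ℕ.m≤n*m n 6)) ℕ.≤-refl)
    in fromℚ ε₀ , fromℚ-pos ε₀ ε₀-pos , λ ε _ → complexity ε }
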